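{- Assume the Set Cover Conjecture. Then for any fixed $\epsilon>0$ there is no algorithm solving the $k$-median Facility Location problem in time $O\big(2^{(1-\epsilon)n}\cdot \mathrm{poly}(m)\big)$, where $n$ is the number of clients and $m$ is the number of candidate centers.
   Context: $k$-median Facility Location: the input is a metric space $(X\cup F,d)$, where $X=\{x_1,\dots,x_n\}$ is a set of $n$ points called clients and $F$ is a set of $m$ candidate centers (facilities), together with a positive integer $k$. The task is to find a pair $(C,P)$, where $C=\{c_1,\dots,c_k\}\subseteq F$ is a set of size at most $k$ and $P$ is a partition of $X$ into $k$ clusters $X_1,\dots,X_k$ such that each client in $X_i$ is assigned to $c_i$, minimizing $\mathrm{cost}(C,P)=\sum_{i=1}^{k}\sum_{x\in X_i} d(c_i,x)$. Set Cover: given a universe $\mathcal{U}$ of $n$ elements, a family $\mathcal{S}=\{S_1,\dots,S_m\}$ of $m$ subsets of $\mathcal{U}$, and an integer $k$, decide whether there is a subfamily of $\mathcal{S}$ of size at most $k$ whose union is $\mathcal{U}$. For $\Delta>0$, $\Delta$-Set Cover is the Set Cover problem restricted to instances in which all the sets of $\mathcal{S}$ have size at most $\Delta$. Set Cover Conjecture (SeCoCo): for every fixed $\epsilon>0$ there is $\Delta(\epsilon)>0$ such that no algorithm (even randomized) solves $\Delta(\epsilon)$-Set Cover in time $O(2^{(1-\epsilon)n}\cdot \mathrm{poly}(m))$. -}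

module Defs where

open import Algebra.Properties.CommutativeMonoid.Sum using (sum)
open import Data.Bool using (Bool; true; false; if_then_else_)
open import Data.Fin using (Fin; toℕ; fromℕ<; splitAt; remQuot)
import Data.Fin as Fin
open import Data.Fin.Subset using (Subset; _∈_; ∣_∣)
open import Data.Integer using () renaming (∣_∣ to abs)
open import Data.List using (List; []; _∷_; foldr; length)
open import Data.List.Relation.Unary.All using (All)
open import Data.List.Relation.Unary.Unique.Propositional using (Unique)
open import Data.Nat
open import Data.Nat.Properties using (m^n≢0)
open import Data.Product using (Σ; ∃; ∃-syntax; _×_; _,_; uncurry)
open import Data.Rational using (ℚ; 0ℚ; ↥_; ↧ₙ_)
import Data.Rational as ℚ
import Data.Rational.Properties as ℚ
open import Data.Sum using (_⊎_; [_,_])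
open import Data.Unit using (⊤)
open import Data.Vec using (Vec; lookup; toList)
open import Function.Definitions using (Injective)
open import Function.Metric.Rational.Structures using (IsMetric)
open import Level using (Level; 0ℓ) renaming (suc to lsuc)
open import Relation.Binary.PropositionalEquality using (_≡_; _≢_)
open import Relation.Nullary using (¬_; yes; no; does)

private
  variable
    ℓ : Level

-- The model of computation is a randomised word RAM with unit cost. A
-- program is a structured program over finitely many arrays of words (a
-- scalar variable is an array used at one index only). All arithmetic is
-- modulo 2 ^ w, where w is the word size; ⊖ is truncated subtraction, and
-- division and remainder by zero return 0.

data Op : Set where
  ⊕ ⊖ ⊗ ⊘ ⊛ : Op

data Expr : Set where
  lit : ℕ → Expr
  get : (array : ℕ) (index : Expr) → Expr
  bin : Op → Expr → Expr → Expr

data Program : Set where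
  skip  : Program
  put   : (array : ℕ) (index value : Expr) → Program
  flip  : (array : ℕ) (index : Expr) → Program
  _⨾_   : Program → Program → Program
  cond  : Expr → Program → Program → Program
  while : Expr → Program → Program

infixr 5 _⨾_

Store : Set
Store = ℕ → ℕ → ℕ

_[_,_≔_] : Store → ℕ → ℕ → ℕ → Store
(σ [ a , i ≔ v ]) b j =
  if does (a ≟ b) then (if does (i ≟ j) then v else σ b j) else σ b j

wrap : (w : ℕ) → ℕ → ℕ
wrap w x = _%_ x (2 ^ w) {{m^n≢0 2 w}}

apply : Op → ℕ → ℕ → ℕ
apply ⊕ x y       = x + y
apply ⊖ x y       = x ∸ y
apply ⊗ x y       = x * y
apply ⊘ x zero    = 0
apply ⊘ x (suc y) = x / suc y
apply ⊛ x zero    = 0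
apply ⊛ x (suc y) = x % suc y

eval : (w : ℕ) → Store → Expr → ℕ
eval w σ (lit c)       = wrap w c
eval w σ (get a e)     = σ a (eval w σ e)
eval w σ (bin o e₁ e₂) = wrap w (apply o (eval w σ e₁) (eval w σ e₂))

bit : Bool → ℕ
bit b = if b then 1 else 0

-- Run w p σ cs t σ′ cs′: with word size w, program p started on store σ and
-- unread random bits cs halts after t steps with store σ′ and unread bits
-- cs′. Every basic command and every test costs one step; the expressions
-- of a fixed program have bounded size. A flip with no bits left is stuck.

data Run (w : ℕ) : Program → Store → List Bool → ℕ → Store → List Bool → Set where
  skip : ∀ {σ cs} → Run w skip σ cs 1 σ cs
  put : ∀ {a i e σ cs} →
    Run w (put a i e) σ cs 1 (σ [ a , eval w σ i ≔ eval w σ e ]) cs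
  flip : ∀ {a i σ c cs} →
    Run w (flip a i) σ (c ∷ cs) 1 (σ [ a , eval w σ i ≔ wrap w (bit c) ]) cs
  seq : ∀ {p q σ₀ σ₁ σ₂ cs₀ cs₁ cs₂ s t} →
    Run w p σ₀ cs₀ s σ₁ cs₁ → Run w q σ₁ cs₁ t σ₂ cs₂ →
    Run w (p ⨾ q) σ₀ cs₀ (s + t) σ₂ cs₂
  cond-true : ∀ {e p q σ σ′ cs cs′ t} → eval w σ e ≢ 0 →
    Run w p σ cs t σ′ cs′ → Run w (cond e p q) σ cs (suc t) σ′ cs′
  cond-false : ∀ {e p q σ σ′ cs cs′ t} → eval w σ e ≡ 0 →
    Run w q σ cs t σ′ cs′ → Run w (cond e p q) σ cs (suc t) σ′ cs′
  while-true : ∀ {e p σ₀ σ₁ σ₂ cs₀ cs₁ cs₂ s t} → eval w σ₀ e ≢ 0 →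
    Run w p σ₀ cs₀ s σ₁ cs₁ → Run w (while e p) σ₁ cs₁ t σ₂ cs₂ →
    Run w (while e p) σ₀ cs₀ (suc (s + t)) σ₂ cs₂
  while-false : ∀ {e p σ cs} → eval w σ e ≡ 0 →
    Run w (while e p) σ cs 1 σ cs

-- n and m are the two size parameters in which running time is measured;
-- Correct I σ says that the store σ holds a correct answer to I.

record Problem (ℓ : Level) : Set (lsuc ℓ) where
  field
    Instance : Set ℓ
    n m      : Instance → ℕ
    input    : Instance → Store
    Correct  : Instance → Store → Set

-- Polynomials with natural coefficients, constant term first.
evalPoly : List ℕ → ℕ → ℕ
evalPoly p x = foldr (λ a r → a + x * r) 0 p

-- t ≤ C · 2^((1-ε)n) · p(m) for ε = a / b > 0, both sides raised to the
-- power b and multiplied by 2^(a n) so that all exponents are natural.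
WithinTime : (ε : ℚ) (C : ℕ) (p : List ℕ) (n m t : ℕ) → Set
WithinTime ε C p n m t =
  t ^ b * 2 ^ (a * n) ≤ (C * evalPoly p m) ^ b * 2 ^ (b * n)
  where
  a = abs (↥ ε)
  b = ↧ₙ ε

module _ (P : Problem ℓ) where
  open Problem P

  -- w ≥ c · log B, where B exceeds 2^n and all numbers in the input: the
  -- usual assumption that a word has room for c numbers of O(n + log m) bits
  -- or from the input. The factor c is chosen by the algorithm, which then
  -- has to work for all such w and so cannot profit from very long words.
  WordSize : (c : ℕ) → Instance → (w : ℕ) → Set
  WordSize c I w =
    ∃[ B ] 2 ^ n I < B × (∀ a i → input I a i < B) × B ^ c ≤ 2 ^ w

  HaltsWith : Program → (w : ℕ) (Within : ℕ → Set) (Result : Store → Set) →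
              Store → List Bool → Set
  HaltsWith prog w Within Result σ cs =
    ∃[ t ] ∃[ σ′ ] ∃[ cs′ ] Run w prog σ cs t σ′ cs′ × Within t × Result σ′

  -- A (possibly randomised) algorithm: some number r of random bits always
  -- suffices, every choice of them leads to a halt within the time bound, and
  -- at least 2/3 of the 2^r choices lead to a correct answer. Deterministic
  -- algorithms are the programs without flip, which need r = 0 bits.
  SolvableInTime : ℚ → Set ℓ
  SolvableInTime ε =
    Σ Program λ prog → ∃[ c ] ∃[ C ] ∃[ p ]
    ((I : Instance) (w : ℕ) → WordSize c I w →
      let Within = WithinTime ε C p (n I) (m I) in
      ∃[ r ]
        ((cs : Vec Bool r) →
          HaltsWith prog w Within (λ _ → ⊤) (input I) (toList cs)) ×
        (Σ (List (Vec Bool r)) λ good →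
          Unique good × 2 * 2 ^ r ≤ 3 * length good ×
          All (λ cs → HaltsWith prog w Within (Correct I) (input I) (toList cs))
              good))

-- Row-major table, 0 outside.
table : ∀ {a b} → (Fin a → Fin b → ℕ) → ℕ → ℕ
table {a} {b} f i with i <? a * b
... | yes i<ab = uncurry f (remQuot b (fromℕ< i<ab))
... | no  _    = 0

scalars : (n m k : ℕ) → ℕ → ℕ
scalars n m k 0 = n
scalars n m k 1 = m
scalars n m k 2 = k
scalars n m k _ = 0

record SetCoverInstance : Set where
  field
    n m k : ℕ
    S     : Fin m → Subset n

  Coverable : Set
  Coverable = Σ (Subset m) λ J → ∣ J ∣ ≤ k × (∀ x → ∃[ j ] j ∈ J × x ∈ S j)

  input : Store
  input 0 = scalars n m k
  input 1 = table λ (x : Fin n) (j : Fin m) → bit (lookup (S j) x)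
  input _ = λ _ → 0

  Correct : Store → Set
  Correct σ = (Coverable × σ 0 0 ≡ 1) ⊎ (¬ Coverable × σ 0 0 ≡ 0)

SetCover : (Δ : ℕ) → Problem 0ℓ
SetCover Δ = record
  { Instance = Σ SetCoverInstance λ I → ∀ j → ∣ SetCoverInstance.S I j ∣ ≤ Δ
  ; n        = λ (I , _) → SetCoverInstance.n I
  ; m        = λ (I , _) → SetCoverInstance.m I
  ; input    = λ (I , _) → SetCoverInstance.input I
  ; Correct  = λ (I , _) → SetCoverInstance.Correct I
  }

SetCoverConjecture : Set
SetCoverConjecture =
  ∀ ε → 0ℚ ℚ.< ε → ∃[ Δ ] 0 < Δ × ¬ SolvableInTime (SetCover Δ) ε

-- Clients and facilities may share points of the metric space.
record KMedianInstance : Set₁ where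
  field
    n m k              : ℕ
    0<k                : 0 < k
    Point              : Set
    client             : Fin n → Point
    facility           : Fin m → Point
    client-injective   : Injective _≡_ _≡_ client
    facility-injective : Injective _≡_ _≡_ facility
    covering           : ∀ p → (∃[ x ] client x ≡ p) ⊎ (∃[ f ] facility f ≡ p)
    d                  : Point → Point → ℚ
    isMetric           : IsMetric _≡_ d

  -- Clusters may be empty and centres may repeat. Having at most k of them,
  -- rather than exactly k, keeps the length of an answer independent of k.
  record Solution : Set where
    field
      size    : ℕ
      size≤k  : size ≤ k
      centre  : Fin size → Fin m
      cluster : Fin n → Fin size

    cost : ℚ
    cost = ∑ λ i → ∑ λ x →
      if does (cluster x Fin.≟ i) then d (facility (centre i)) (client x) else 0ℚ
      where ∑ = λ {l} → sum ℚ.+-0-commutativeMonoid {l}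

    StoredIn : Store → Set
    StoredIn σ =
      σ 3 0 ≡ size ×
      (∀ i → σ 4 (toℕ i) ≡ toℕ (centre i)) ×
      (∀ x → σ 5 (toℕ x) ≡ toℕ (cluster x))

  Optimal : Solution → Set
  Optimal s = ∀ s′ → Solution.cost s ℚ.≤ Solution.cost s′

  point : Fin (n + m) → Point
  point u = [ client , facility ] (splitAt n u)

  -- Distances are nonnegative, so the absolute value of the numerator loses
  -- nothing.
  input : Store
  input 0 = scalars n m k
  input 1 = table λ (u v : Fin (n + m)) → abs (↥ d (point u) (point v))
  input 2 = table λ (u v : Fin (n + m)) → ↧ₙ d (point u) (point v)
  input _ = λ _ → 0

  -- Nothing is asked of instances without a solution (those with clients
  -- but no facilities).
  Correct : Store → Set
  Correct σ = Solution → Σ Solution λ s → Optimal s × Solution.StoredIn s σ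

KMedian : Problem (lsuc 0ℓ)
KMedian = record
  { Instance = KMedianInstance
  ; n        = KMedianInstance.n
  ; m        = KMedianInstance.m
  ; input    = KMedianInstance.input
  ; Correct  = KMedianInstance.Correct
  }

{-# OPTIONS --safe #-}
module Submission where

open import Defs
open import Data.Rational using (ℚ; 0ℚ; _<_)
open import Relation.Nullary using (¬_)

open import Algebra.Properties.CommutativeMonoid.Sum using (sum)
open import Data.Bool using (Bool; true; false; if_then_else_)
open import Data.Fin as Fin using (Fin; zero; suc; toℕ; fromℕ<; splitAt; remQuot; join)
open import Data.Fin.Properties using (toℕ<n; toℕ-fromℕ<; toℕ-injective; toℕ-combine; remQuot-combine; combine-surjective; toℕ-↑ˡ; toℕ-↑ʳ; join-splitAt)
open import Data.Fin.Subset using (Subset; inside; outside; _∈_; ∣_∣; ⊥; ⁅_⁆; _∪_)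
open import Data.Fin.Subset.Properties using (∣⊥∣≡0; ∣⁅x⁆∣≡1; x∈⁅x⁆; x∈p∪q⁺; ∣p∣≤∣x∷p∣)
import Data.Integer as ℤ
import Data.Integer.Properties as ℤ
open import Data.List using (List; []; _∷_; length)
open import Data.List.Relation.Unary.All as All using (All; []; _∷_)
open import Data.List.Relation.Unary.AllPairs using ([]; _∷_)
open import Data.List.Relation.Unary.Unique.Propositional using (Unique)
import Data.Nat.Coprimality as Coprimality
open import Data.Nat as ℕ using (ℕ; zero; suc; _+_; _*_; _∸_; _^_; _%_; _/_; _≤_; z≤n; s≤s; _<?_; _≟_; NonZero)
open import Data.Nat.Divisibility using (m∣m*n)
open import Data.Nat.DivMod using (m≡m%n+[m/n]*n; m%n<n; m%n≤m; m/n≤m; m<n⇒m%n≡m; [m+kn]%n≡m%n; +-distrib-/-∣ˡ; m*n/n≡m; m<n⇒m/n≡0)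
open import Data.Nat.Properties
open import Data.Nat.Tactic.RingSolver using (solve-∀)
open import Data.Product using (∃-syntax; _×_; _,_; proj₁; proj₂; uncurry)
import Data.Rational as ℚ
open import Data.Rational using (mkℚ)
import Data.Rational.Properties as ℚ
import Data.Rational.Unnormalised as ℚᵘ
import Data.Rational.Unnormalised.Properties as ℚᵘ
open import Data.Sum using (_⊎_; inj₁; inj₂; [_,_])
open import Data.Sum.Properties using (inj₁-injective; inj₂-injective)
open import Data.Unit using (⊤; tt)
open import Data.Vec using (Vec; []; _∷_; here; there; lookup; toList)
open import Data.Vec.Properties using ([]=⇒lookup; lookup⇒[]=)
open import Function using (_∘_)
open import Function.Metric.Rational.Structures using (IsMetric)
open import Relation.Binary.PropositionalEquality hiding ([_])
open import Relation.Nullary using (Dec; yes; no; does; contradiction)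
open import Relation.Nullary.Decidable using (dec-true; dec-false)

-- Turn every element into a client and every set into a candidate centre, at distance 1 from
-- its members and 3 from the other elements; two distinct clients, or two distinct centres,
-- are at distance 2. This is a metric, every solution costs at least n, and the cost n is
-- reached exactly when the chosen sets cover. Neither n nor m changes, so an algorithm for
-- k-median decides Set Cover with an overhead of O((n + m)²) steps for writing down the
-- distances and checking the assignment it returns. To absorb a power of n in
-- 2^((1-ε)n), ε = a/b is first lowered to 1/(2b).

-- Moving a program to higher arrays

-- Moving a program up by three arrays leaves 0 and 1 for the Set Cover input and 2 for scratch.

-- The difficulty lies in what may be concluded from the words that the solver leaves behind.
-- Unlucky random bits can leave anything there and the reduction must still halt in time, so the
-- check runs for exactly n rounds whatever the arrays contain. It neither computes a cost nor
-- counts centres: it only asks whether each client is a member of the set stored for it. If the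
-- sets cover, the optimum attains the lower bound client by client, so every test succeeds. If
-- every test succeeds, the number of centres is at most k because the stored words encode a genuine
-- solution; but `Correct` promises this only when some solution exists, so one has to be built from
-- the passed tests themselves. An instance with k = 0 has no k-median counterpart and is answered
-- directly. The conjecture speaks about every positive exponent, so it may be invoked at the
-- lowered one. Lowering also takes care of ε ≥ 1, where the assumed time bound by itself would
-- leave no room for work that grows with n.

relocateᵉ : Expr → Expr
relocateᵉ (lit c)       = lit c
relocateᵉ (get a e)     = get (3 + a) (relocateᵉ e)
relocateᵉ (bin o e₁ e₂) = bin o (relocateᵉ e₁) (relocateᵉ e₂)

relocate : Program → Program
relocate skip         = skip
relocate (put a i e)  = put (3 + a) (relocateᵉ i) (relocateᵉ e)
relocate (flip a i)   = flip (3 + a) (relocateᵉ i)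
relocate (p ⨾ q)      = relocate p ⨾ relocate q
relocate (cond e p q) = cond (relocateᵉ e) (relocate p) (relocate q)
relocate (while e p)  = while (relocateᵉ e) (relocate p)

Relocated : Store → Store → Set
Relocated σ τ = ∀ a i → τ (3 + a) i ≡ σ a i

eval-relocate : ∀ w {σ τ} → Relocated σ τ → ∀ e → eval w τ (relocateᵉ e) ≡ eval w σ e
eval-relocate w {σ} {τ} στ (lit c) = refl
eval-relocate w {σ} {τ} στ (get a e) =
  trans (cong (τ (3 + a)) (eval-relocate w στ e)) (στ a _)
eval-relocate w στ (bin o e₁ e₂) =
  cong₂ (λ x y → wrap w (apply o x y)) (eval-relocate w στ e₁) (eval-relocate w στ e₂)

update-relocated : ∀ {σ τ} → Relocated σ τ → ∀ a {i i′ v v′} → i′ ≡ i → v′ ≡ v →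
                   Relocated (σ [ a , i ≔ v ]) (τ [ 3 + a , i′ ≔ v′ ])
update-relocated στ a {i} {v = v} refl refl b j =
  cong (λ x → if does (a ≟ b) then (if does (i ≟ j) then v else x) else x) (στ b j)

AgreeBelow3 : Store → Store → Set
AgreeBelow3 σ τ = ∀ a i → a ℕ.< 3 → τ a i ≡ σ a i

update-agree : ∀ {σ} a {i v} → AgreeBelow3 σ (σ [ 3 + a , i ≔ v ])
update-agree a 0 j _ = refl
update-agree a 1 j _ = refl
update-agree a 2 j _ = refl
update-agree a (suc (suc (suc _))) j (s≤s (s≤s (s≤s ())))

agree-refl : ∀ {σ} → AgreeBelow3 σ σ
agree-refl _ _ _ = refl

agree-trans : ∀ {σ τ υ} → AgreeBelow3 σ τ → AgreeBelow3 τ υ → AgreeBelow3 σ υ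
agree-trans στ τυ a i a<3 = trans (τυ a i a<3) (στ a i a<3)

-- Array numbers are literals of the syntax and only indices are computed, so renaming the arrays
-- changes neither the control flow, nor the step count, nor the random bits read. `AgreeBelow3` is
-- the frame condition that carries the Set Cover input and the scratch array across the call.
run-relocate : ∀ {w p σ cs t σ′ cs′ τ} → Run w p σ cs t σ′ cs′ → Relocated σ τ →
  ∃[ τ′ ] Run w (relocate p) τ cs t τ′ cs′ × Relocated σ′ τ′ × AgreeBelow3 τ τ′
run-relocate skip στ = _ , skip , στ , agree-refl
run-relocate {w} {τ = τ} (put {a} {i} {e}) στ =
  _ , put , update-relocated {τ = τ} στ a (eval-relocate w στ i) (eval-relocate w στ e) ,
  update-agree a {eval w τ (relocateᵉ i)} {eval w τ (relocateᵉ e)}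
run-relocate {w} {τ = τ} (flip {a} {i}) στ =
  _ , flip , update-relocated {τ = τ} στ a (eval-relocate w στ i) refl ,
  update-agree a {eval w τ (relocateᵉ i)}
run-relocate (seq r s) στ =
  let _ , r′ , στ₁ , agree₁ = run-relocate r στ
      _ , s′ , στ₂ , agree₂ = run-relocate s στ₁
  in _ , seq r′ s′ , στ₂ , agree-trans agree₁ agree₂
run-relocate {w} (cond-true {e} ≢0 r) στ =
  let _ , r′ , στ′ , agree = run-relocate r στ
  in _ , cond-true (λ eq → ≢0 (trans (sym (eval-relocate w στ e)) eq)) r′ , στ′ , agree
run-relocate {w} (cond-false {e} ≡0 r) στ =
  let _ , r′ , στ′ , agree = run-relocate r στ
  in _ , cond-false (trans (eval-relocate w στ e) ≡0) r′ , στ′ , agree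
run-relocate {w} (while-true {e} ≢0 r s) στ =
  let _ , r′ , στ₁ , agree₁ = run-relocate r στ
      _ , s′ , στ₂ , agree₂ = run-relocate s στ₁
  in _ , while-true (λ eq → ≢0 (trans (sym (eval-relocate w στ e)) eq)) r′ s′ ,
       στ₂ , agree-trans agree₁ agree₂
run-relocate {w} (while-false {e} ≡0) στ =
  _ , while-false (trans (eval-relocate w στ e) ≡0) , στ , agree-refl

-- Evaluation without overflow, and counted loops

infixl 7 _*ᵉ_ _/ᵉ_ _%ᵉ_
infixl 6 _+ᵉ_ _-ᵉ_

_+ᵉ_ _-ᵉ_ _*ᵉ_ _/ᵉ_ _%ᵉ_ : Expr → Expr → Expr
_+ᵉ_ = bin ⊕
_-ᵉ_ = bin ⊖
_*ᵉ_ = bin ⊗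
_/ᵉ_ = bin ⊘
_%ᵉ_ = bin ⊛

-- A conditional inside an expression: with truncated subtraction, 1 - (1 - c) is 1 for nonzero c
-- and 0 otherwise. Both branches are evaluated, but the rejected one is multiplied by 0, so it may
-- hold a wrapped or meaningless value. A distance thereby costs a single `put`.
select : Expr → Expr → Expr → Expr
select c e₁ e₂ = (lit 1 -ᵉ (lit 1 -ᵉ c)) *ᵉ e₁ +ᵉ (lit 1 -ᵉ c) *ᵉ e₂

module WordRAM (w : ℕ) (1<2^w : 1 ℕ.< 2 ^ w) where

  infix 4 _⊢_⇓_

  -- A record, so that unification recovers σ and e from the type.
  record _⊢_⇓_ (σ : Store) (e : Expr) (v : ℕ) : Set where
    constructor value
    field
      eval≡ : eval w σ e ≡ v

  open _⊢_⇓_ public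

  wrap-small : ∀ {x} → x ℕ.< 2 ^ w → wrap w x ≡ x
  wrap-small = m<n⇒m%n≡m {{m^n≢0 2 w}}

  0<2^w : 0 ℕ.< 2 ^ w
  0<2^w = <-trans (s≤s z≤n) 1<2^w

  ⇓-lit : ∀ {σ c} → c ℕ.< 2 ^ w → σ ⊢ lit c ⇓ c
  ⇓-lit c< = value (wrap-small c<)

  ⇓-get : ∀ {σ a e x v} → σ ⊢ e ⇓ x → σ a x ≡ v → σ ⊢ get a e ⇓ v
  ⇓-get (value refl) eq = value eq

  ⇓-bin : ∀ o {σ e₁ e₂ x y z} → σ ⊢ e₁ ⇓ x → σ ⊢ e₂ ⇓ y → apply o x y ≡ z → z ℕ.< 2 ^ w →
          σ ⊢ bin o e₁ e₂ ⇓ z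
  ⇓-bin o (value refl) (value refl) refl z< = value (wrap-small z<)

  ⇓-+ : ∀ {σ e₁ e₂ x y} → σ ⊢ e₁ ⇓ x → σ ⊢ e₂ ⇓ y → x + y ℕ.< 2 ^ w → σ ⊢ e₁ +ᵉ e₂ ⇓ x + y
  ⇓-+ p q = ⇓-bin ⊕ p q refl

  ⇓-* : ∀ {σ e₁ e₂ x y} → σ ⊢ e₁ ⇓ x → σ ⊢ e₂ ⇓ y → x * y ℕ.< 2 ^ w → σ ⊢ e₁ *ᵉ e₂ ⇓ x * y
  ⇓-* p q = ⇓-bin ⊗ p q refl

  ⇓-∸ : ∀ {σ e₁ e₂ x y} → σ ⊢ e₁ ⇓ x → σ ⊢ e₂ ⇓ y → x ℕ.< 2 ^ w → σ ⊢ e₁ -ᵉ e₂ ⇓ x ∸ y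
  ⇓-∸ {x = x} {y} p q x< = ⇓-bin ⊖ p q refl (≤-<-trans (m∸n≤m x y) x<)

  ⇓-/ : ∀ {σ e₁ e₂ x y} .{{_ : NonZero y}} → σ ⊢ e₁ ⇓ x → σ ⊢ e₂ ⇓ y → x ℕ.< 2 ^ w →
        σ ⊢ e₁ /ᵉ e₂ ⇓ x / y
  ⇓-/ {x = x} {y@(suc _)} p q x< = ⇓-bin ⊘ p q refl (≤-<-trans (m/n≤m x y) x<)

  ⇓-% : ∀ {σ e₁ e₂ x y} .{{_ : NonZero y}} → σ ⊢ e₁ ⇓ x → σ ⊢ e₂ ⇓ y → x ℕ.< 2 ^ w →
        σ ⊢ e₁ %ᵉ e₂ ⇓ x % y
  ⇓-% {x = x} {y@(suc _)} p q x< = ⇓-bin ⊛ p q refl (≤-<-trans (m%n≤m x y) x<)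

  ⇓-select-suc : ∀ {σ c e₁ e₂ b x} → σ ⊢ c ⇓ b → b ≢ 0 → σ ⊢ e₁ ⇓ x → x ℕ.< 2 ^ w →
                 σ ⊢ select c e₁ e₂ ⇓ x
  ⇓-select-suc {σ} {c} {e₂ = e₂} {x = x} p b≢0 q x< =
    ⇓-bin ⊕ (⇓-bin ⊗ (⇓-bin ⊖ one 1-c⇓0 refl 1<2^w) q (*-identityˡ x) x<)
            (⇓-bin ⊗ {e₂ = e₂} 1-c⇓0 (value refl) refl 0<2^w) (+-identityʳ x) x<
    where
    one = ⇓-lit 1<2^w
    1-c⇓0 : σ ⊢ lit 1 -ᵉ c ⇓ 0
    1-c⇓0 = ⇓-bin ⊖ one p (m≤n⇒m∸n≡0 (n≢0⇒n>0 b≢0)) 0<2^w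

  ⇓-select-zero : ∀ {σ c e₁ e₂ x} → σ ⊢ c ⇓ 0 → σ ⊢ e₂ ⇓ x → x ℕ.< 2 ^ w →
                  σ ⊢ select c e₁ e₂ ⇓ x
  ⇓-select-zero {σ} {c} {e₁} {x = x} p q x< =
    ⇓-bin ⊕ (⇓-bin ⊗ {e₂ = e₁} (⇓-bin ⊖ one 1-c⇓1 refl 0<2^w) (value refl) refl 0<2^w)
            (⇓-bin ⊗ 1-c⇓1 q (*-identityˡ x) x<) refl x<
    where
    one = ⇓-lit 1<2^w
    1-c⇓1 : σ ⊢ lit 1 -ᵉ c ⇓ 1
    1-c⇓1 = ⇓-bin ⊖ one p refl 1<2^w

  Halts : Program → Store → List Bool → ℕ → (Store → Set) → Set
  Halts p σ cs T Q = ∃[ t ] ∃[ σ′ ] Run w p σ cs t σ′ cs × t ≤ T × Q σ′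

  run-put : ∀ {a e₁ e₂ i v σ cs} → σ ⊢ e₁ ⇓ i → σ ⊢ e₂ ⇓ v →
            Run w (put a e₁ e₂) σ cs 1 (σ [ a , i ≔ v ]) cs
  run-put (value refl) (value refl) = put

  -- The guard has to evaluate to the number of rounds left, which gives both the exit test and the
  -- bound: each round costs its body and one test, and the final test costs one more. `Halts`
  -- returns the bits `cs` untouched, since only the solver flips coins.
  while-halts : ∀ {e p cs s N} (Inv : ℕ → Store → Set) →
    (∀ {i σ} → Inv i σ → σ ⊢ e ⇓ N ∸ i) →
    (∀ {i σ} → i ℕ.< N → Inv i σ → Halts p σ cs s (Inv (suc i))) →
    ∀ j {i σ} → i + j ≡ N → Inv i σ → Halts (while e p) σ cs (1 + j * suc s) (Inv N)
  while-halts Inv guard step zero {i} i+0≡N inv with refl ← trans (sym (+-identityʳ i)) i+0≡N =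
    1 , _ , while-false (trans (eval≡ (guard inv)) (n∸n≡0 i)) , ≤-refl , inv
  while-halts {s = s} {N} Inv guard step (suc j) {i} i+1+j≡N inv =
    let s₁ , _ , r₁ , s₁≤s , inv₁ = step i<N inv
        s₂ , _ , r₂ , s₂≤ , inv₂ = while-halts Inv guard step j (trans (sym (+-suc i j)) i+1+j≡N) inv₁
    in _ , _ , while-true (λ eq → m>n⇒m∸n≢0 i<N (trans (sym (eval≡ (guard inv))) eq)) r₁ r₂ ,
       s≤s (≤-trans (+-mono-≤ s₁≤s s₂≤) (≤-reflexive (+-suc s (j * suc s)))) , inv₂
    where
    i<N : i ℕ.< N
    i<N = subst (suc i ≤_) (trans (sym (+-suc i j)) i+1+j≡N) (m≤m+n (suc i) j)

-- Passing between subfamilies and lists of centres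

enumerate : ∀ {m} (J : Subset m) → Fin ∣ J ∣ → Fin m
enumerate (inside  ∷ J) zero    = zero
enumerate (inside  ∷ J) (suc i) = suc (enumerate J i)
enumerate (outside ∷ J) i       = suc (enumerate J i)

enumerate-surjective : ∀ {m} {J : Subset m} {j} → j ∈ J → ∃[ i ] enumerate J i ≡ j
enumerate-surjective here = zero , refl
enumerate-surjective {J = inside ∷ J} (there j∈J) =
  let i , eq = enumerate-surjective j∈J in suc i , cong suc eq
enumerate-surjective {J = outside ∷ J} (there j∈J) =
  let i , eq = enumerate-surjective j∈J in i , cong suc eq

∣p∪q∣≤∣p∣+∣q∣ : ∀ {m} (p q : Subset m) → ∣ p ∪ q ∣ ≤ ∣ p ∣ + ∣ q ∣
∣p∪q∣≤∣p∣+∣q∣ [] [] = z≤n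
∣p∪q∣≤∣p∣+∣q∣ (outside ∷ p) (outside ∷ q) = ∣p∪q∣≤∣p∣+∣q∣ p q
∣p∪q∣≤∣p∣+∣q∣ (outside ∷ p) (inside  ∷ q) =
  ≤-trans (s≤s (∣p∪q∣≤∣p∣+∣q∣ p q)) (≤-reflexive (sym (+-suc ∣ p ∣ ∣ q ∣)))
∣p∪q∣≤∣p∣+∣q∣ (inside  ∷ p) (y ∷ q) =
  s≤s (≤-trans (∣p∪q∣≤∣p∣+∣q∣ p q) (+-monoʳ-≤ ∣ p ∣ (∣p∣≤∣x∷p∣ y q)))

image : ∀ {s m} → (Fin s → Fin m) → Subset m
image {zero}  f = ⊥
image {suc s} f = ⁅ f zero ⁆ ∪ image (f ∘ suc)

∣image∣≤ : ∀ {s m} (f : Fin s → Fin m) → ∣ image f ∣ ≤ s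
∣image∣≤ {zero}  {m} f = ≤-reflexive (∣⊥∣≡0 m)
∣image∣≤ {suc s} f =
  ≤-trans (∣p∪q∣≤∣p∣+∣q∣ ⁅ f zero ⁆ _) (+-mono-≤ (≤-reflexive (∣⁅x⁆∣≡1 (f zero))) (∣image∣≤ (f ∘ suc)))

∈image : ∀ {s m} (f : Fin s → Fin m) i → f i ∈ image f
∈image f zero    = x∈p∪q⁺ (inj₁ (x∈⁅x⁆ (f zero)))
∈image f (suc i) = x∈p∪q⁺ (inj₂ (∈image (f ∘ suc) i))

-- Natural numbers as rationals, and finite sums

-- Given directly in lowest terms so that numerator and denominator reduce: the two input tables of
-- the k-median instance are then `dist` and the constant 1 by computation.
fromℕ : ℕ → ℚ
fromℕ n = mkℚ (ℤ.+ n) 0 (Coprimality.sym (Coprimality.1-coprimeTo n))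

fromℕ-+ : ∀ m n → fromℕ (m + n) ≡ fromℕ m ℚ.+ fromℕ n
fromℕ-+ m n = ℚ.toℚᵘ-injective (ℚᵘ.≃-trans
  (ℚᵘ.*≡* (cong (ℤ._* (ℤ.+ 1)) (sym (cong₂ ℤ._+_ (ℤ.*-identityʳ (ℤ.+ m)) (ℤ.*-identityʳ (ℤ.+ n))))))
  (ℚᵘ.≃-sym (ℚ.toℚᵘ-homo-+ (fromℕ m) (fromℕ n))))

fromℕ-injective : ∀ {m n} → fromℕ m ≡ fromℕ n → m ≡ n
fromℕ-injective refl = refl

fromℕ-mono-≤ : ∀ {m n} → m ≤ n → fromℕ m ℚ.≤ fromℕ n
fromℕ-mono-≤ m≤n = ℚ.*≤* (ℤ.*-monoʳ-≤-nonNeg (ℤ.+ 1) (ℤ.+≤+ m≤n))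

fromℕ-cancel-≤ : ∀ {m n} → fromℕ m ℚ.≤ fromℕ n → m ≤ n
fromℕ-cancel-≤ {m} {n} p =
  ℤ.drop‿+≤+ (subst₂ ℤ._≤_ (ℤ.*-identityʳ (ℤ.+ m)) (ℤ.*-identityʳ (ℤ.+ n)) (ℚ.drop-*≤* p))

∑ℕ : ∀ {n} → (Fin n → ℕ) → ℕ
∑ℕ = sum +-0-commutativeMonoid

∑ℚ : ∀ {n} → (Fin n → ℚ) → ℚ
∑ℚ = sum ℚ.+-0-commutativeMonoid

open Algebra.Properties.CommutativeMonoid.Sum ℚ.+-0-commutativeMonoid
  using (sum-cong-≗; sum-replicate-zero; ∑-comm)

∑ℚ-fromℕ : ∀ {n} (f : Fin n → ℕ) → ∑ℚ (fromℕ ∘ f) ≡ fromℕ (∑ℕ f)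
∑ℚ-fromℕ {zero}  f = refl
∑ℚ-fromℕ {suc n} f =
  trans (cong (fromℕ (f zero) ℚ.+_) (∑ℚ-fromℕ (f ∘ suc))) (sym (fromℕ-+ (f zero) _))

∑ℚ-indicator : ∀ {n} (j : Fin n) (g : Fin n → ℚ) →
               ∑ℚ (λ i → if does (j Fin.≟ i) then g i else 0ℚ) ≡ g j
∑ℚ-indicator {suc n} zero g =
  trans (cong (g zero ℚ.+_) (sum-replicate-zero n)) (ℚ.+-identityʳ (g zero))
∑ℚ-indicator {suc n} (suc j) g = trans (ℚ.+-identityˡ _) (∑ℚ-indicator j (g ∘ suc))

∑ℕ-mono-≤ : ∀ {n} {f g : Fin n → ℕ} → (∀ i → f i ≤ g i) → ∑ℕ f ≤ ∑ℕ g
∑ℕ-mono-≤ {zero}  f≤g = z≤n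
∑ℕ-mono-≤ {suc n} f≤g = +-mono-≤ (f≤g zero) (∑ℕ-mono-≤ (f≤g ∘ suc))

∑ℕ-tight : ∀ {n} {f g : Fin n → ℕ} → (∀ i → f i ≤ g i) → ∑ℕ g ≤ ∑ℕ f → ∀ i → g i ≤ f i
∑ℕ-tight {suc n} {f} {g} f≤g ∑g≤∑f zero = +-cancelʳ-≤ (∑ℕ (g ∘ suc)) (g zero) (f zero)
  (≤-trans ∑g≤∑f (+-monoʳ-≤ (f zero) (∑ℕ-mono-≤ (f≤g ∘ suc))))
∑ℕ-tight {suc n} {f} {g} f≤g ∑g≤∑f (suc i) = ∑ℕ-tight (f≤g ∘ suc)
  (+-cancelˡ-≤ (g zero) _ _ (≤-trans ∑g≤∑f (+-monoˡ-≤ _ (f≤g zero)))) i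

-- The metric and its optimal solutions

module Reduction (I : SetCoverInstance) (0<k : 0 ℕ.< SetCoverInstance.k I) where

  open SetCoverInstance I

  discrete : ∀ {l} → Fin l → Fin l → ℕ
  discrete x y = if does (x Fin.≟ y) then 0 else 2

  -- Arithmetic instead of a case distinction, so that the machine expression `crossᵉ` can follow it
  -- term by term.
  cross : Fin n → Fin m → ℕ
  cross x j = 3 ∸ 2 * bit (lookup (S j) x)

  dist : Fin n ⊎ Fin m → Fin n ⊎ Fin m → ℕ
  dist (inj₁ x) (inj₁ y) = discrete x y
  dist (inj₁ x) (inj₂ j) = cross x j
  dist (inj₂ i) (inj₁ y) = cross y i
  dist (inj₂ i) (inj₂ j) = discrete i j

  discrete-cases : ∀ {l} (x y : Fin l) → x ≡ y × discrete x y ≡ 0 ⊎ x ≢ y × discrete x y ≡ 2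
  discrete-cases x y with x Fin.≟ y
  ... | yes x≡y = inj₁ (x≡y , refl)
  ... | no  x≢y = inj₂ (x≢y , refl)

  discrete-refl : ∀ {l} (x : Fin l) → discrete x x ≡ 0
  discrete-refl x with discrete-cases x x
  ... | inj₁ (_ , ≡0) = ≡0
  ... | inj₂ (x≢x , _) = contradiction refl x≢x

  discrete≡0⇒≡ : ∀ {l} {x y : Fin l} → discrete x y ≡ 0 → x ≡ y
  discrete≡0⇒≡ {x = x} {y} ≡0 with discrete-cases x y
  ... | inj₁ (x≡y , _) = x≡y
  ... | inj₂ (_ , ≡2) with () ← trans (sym ≡2) ≡0

  discrete-sym : ∀ {l} (x y : Fin l) → discrete x y ≡ discrete y x
  discrete-sym x y with discrete-cases x y | discrete-cases y x
  ... | inj₁ (_ , p)    | inj₁ (_ , q)    = trans p (sym q)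
  ... | inj₂ (_ , p)    | inj₂ (_ , q)    = trans p (sym q)
  ... | inj₁ (refl , _) | inj₂ (y≢x , _)  = contradiction refl y≢x
  ... | inj₂ (x≢y , _)  | inj₁ (refl , _) = contradiction refl x≢y

  discrete≤2 : ∀ {l} (x y : Fin l) → discrete x y ≤ 2
  discrete≤2 x y with does (x Fin.≟ y)
  ... | true  = z≤n
  ... | false = ≤-refl

  discrete-triangle : ∀ {l} (x y z : Fin l) → discrete x z ≤ discrete x y + discrete y z
  discrete-triangle x y z with discrete-cases x y
  ... | inj₁ (refl , _) = m≤n+m (discrete y z) (discrete y y)
  ... | inj₂ (_ , ≡2) rewrite ≡2 = m≤n⇒m≤n+o (discrete y z) (discrete≤2 x z)

  1≤cross : ∀ x j → 1 ≤ cross x j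
  1≤cross x j with lookup (S j) x
  ... | true  = ≤-refl
  ... | false = s≤s z≤n

  cross≤3 : ∀ x j → cross x j ≤ 3
  cross≤3 x j = m∸n≤m 3 (2 * bit (lookup (S j) x))

  -- Between distinct clients this is 3 ≤ 2 + 1, the inequality that keeps `discrete` from using a
  -- value below 2.
  cross-triangleˡ : ∀ x y j → cross x j ≤ discrete x y + cross y j
  cross-triangleˡ x y j with discrete-cases x y
  ... | inj₁ (refl , _) = m≤n+m (cross y j) (discrete y y)
  ... | inj₂ (_ , ≡2) rewrite ≡2 = ≤-trans (cross≤3 x j) (+-monoʳ-≤ 2 (1≤cross y j))

  cross-triangleʳ : ∀ x i j → cross x j ≤ cross x i + discrete i j
  cross-triangleʳ x i j with discrete-cases i j
  ... | inj₁ (refl , _) = m≤m+n (cross x i) (discrete i i)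
  ... | inj₂ (_ , ≡2) rewrite ≡2 = ≤-trans (cross≤3 x j) (+-monoˡ-≤ 2 (1≤cross x i))

  dist-refl : ∀ u → dist u u ≡ 0
  dist-refl (inj₁ x) = discrete-refl x
  dist-refl (inj₂ j) = discrete-refl j

  dist≡0⇒≡ : ∀ u v → dist u v ≡ 0 → u ≡ v
  dist≡0⇒≡ (inj₁ x) (inj₁ y) ≡0 = cong inj₁ (discrete≡0⇒≡ ≡0)
  dist≡0⇒≡ (inj₁ x) (inj₂ j) ≡0 = contradiction (1≤cross x j) (<⇒≱ (s≤s (≤-reflexive ≡0)))
  dist≡0⇒≡ (inj₂ i) (inj₁ y) ≡0 = contradiction (1≤cross y i) (<⇒≱ (s≤s (≤-reflexive ≡0)))
  dist≡0⇒≡ (inj₂ i) (inj₂ j) ≡0 = cong inj₂ (discrete≡0⇒≡ ≡0)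

  dist-sym : ∀ u v → dist u v ≡ dist v u
  dist-sym (inj₁ x) (inj₁ y) = discrete-sym x y
  dist-sym (inj₁ x) (inj₂ j) = refl
  dist-sym (inj₂ i) (inj₁ y) = refl
  dist-sym (inj₂ i) (inj₂ j) = discrete-sym i j

  dist-triangle : ∀ u v w → dist u w ≤ dist u v + dist v w
  dist-triangle (inj₁ x) (inj₁ y) (inj₁ z) = discrete-triangle x y z
  dist-triangle (inj₁ x) (inj₁ y) (inj₂ k) = cross-triangleˡ x y k
  -- The opposite constraint: two members of one set are joined by a path of length 1 + 1, so 2 is
  -- also the largest value allowed.
  dist-triangle (inj₁ x) (inj₂ j) (inj₁ z) =
    ≤-trans (discrete≤2 x z) (+-mono-≤ (1≤cross x j) (1≤cross z j))
  dist-triangle (inj₁ x) (inj₂ j) (inj₂ k) = cross-triangleʳ x j k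
  dist-triangle (inj₂ i) (inj₁ y) (inj₁ z) = subst (cross z i ≤_)
    (trans (cong (_+ cross y i) (discrete-sym z y)) (+-comm (discrete y z) (cross y i)))
    (cross-triangleˡ z y i)
  dist-triangle (inj₂ i) (inj₁ y) (inj₂ k) =
    ≤-trans (discrete≤2 i k) (+-mono-≤ (1≤cross y i) (1≤cross y k))
  dist-triangle (inj₂ i) (inj₂ j) (inj₁ z) = subst (cross z i ≤_)
    (trans (cong (_+_ (cross z j)) (discrete-sym j i)) (+-comm (cross z j) (discrete i j)))
    (cross-triangleʳ z j i)
  dist-triangle (inj₂ i) (inj₂ j) (inj₂ k) = discrete-triangle i j k

  dist≤3 : ∀ u v → dist u v ≤ 3
  dist≤3 (inj₁ x) (inj₁ y) = m≤n⇒m≤1+n (discrete≤2 x y)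
  dist≤3 (inj₁ x) (inj₂ j) = cross≤3 x j
  dist≤3 (inj₂ i) (inj₁ y) = cross≤3 y i
  dist≤3 (inj₂ i) (inj₂ j) = m≤n⇒m≤1+n (discrete≤2 i j)

  distℚ : Fin n ⊎ Fin m → Fin n ⊎ Fin m → ℚ
  distℚ u v = fromℕ (dist u v)

  distℚ-isMetric : IsMetric _≡_ distℚ
  distℚ-isMetric = record
    { isSemiMetric = record
      { isQuasiSemiMetric = record
        { isPreMetric = record
          { isProtoMetric = record
            { isPartialOrder  = ℚ.≤-isPartialOrder
            ; ≈-isEquivalence = isEquivalence
            ; cong            = cong₂ distℚ
            ; nonNegative     = fromℕ-mono-≤ z≤n
            }
          ; ≈⇒0 = λ { {u} refl → cong fromℕ (dist-refl u) }
          }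
        ; 0⇒≈ = λ {u} {v} → dist≡0⇒≡ u v ∘ fromℕ-injective
        }
      ; sym = λ u v → cong fromℕ (dist-sym u v)
      }
    ; triangle = λ u v w → subst (distℚ u w ℚ.≤_) (fromℕ-+ (dist u v) (dist v w))
                                (fromℕ-mono-≤ (dist-triangle u v w))
    }

  kMedian : KMedianInstance
  kMedian = record
    { n                  = n
    ; m                  = m
    ; k                  = k
    ; 0<k                = 0<k
    ; Point              = Fin n ⊎ Fin m
    ; client             = inj₁
    ; facility           = inj₂
    ; client-injective   = inj₁-injective
    ; facility-injective = inj₂-injective
    ; covering           = λ { (inj₁ x) → inj₁ (x , refl) ; (inj₂ j) → inj₂ (j , refl) }
    ; d                  = distℚ
    ; isMetric           = distℚ-isMetric
    }

  open KMedianInstance kMedian using (Solution; Optimal; module Solution)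

  CentresCover : Solution → Set
  CentresCover s = ∀ x → x ∈ S (Solution.centre s (Solution.cluster s x))

  -- After exchanging the sums, the inner sum over clusters has one surviving term for each client.
  -- With integer terms the cost can then be compared client by client.
  cost≡ : ∀ s → Solution.cost s ≡
                fromℕ (∑ℕ λ x → cross x (Solution.centre s (Solution.cluster s x)))
  cost≡ s = begin
    cost
      ≡⟨ ∑-comm (λ i x → if does (cluster x Fin.≟ i) then distℚ (inj₂ (centre i)) (inj₁ x) else 0ℚ) ⟩
    (∑ℚ λ x → ∑ℚ λ i → if does (cluster x Fin.≟ i) then fromℕ (cross x (centre i)) else 0ℚ)
      ≡⟨ sum-cong-≗ (λ x → ∑ℚ-indicator (cluster x) (λ i → fromℕ (cross x (centre i)))) ⟩
    (∑ℚ λ x → fromℕ (cross x (centre (cluster x))))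
      ≡⟨ ∑ℚ-fromℕ (λ x → cross x (centre (cluster x))) ⟩
    fromℕ (∑ℕ λ x → cross x (centre (cluster x))) ∎
    where
    open ≡-Reasoning
    open Solution s

  ∈⇒cross≡1 : ∀ {x j} → x ∈ S j → cross x j ≡ 1
  ∈⇒cross≡1 x∈Sj rewrite []=⇒lookup x∈Sj = refl

  cross≤1⇒∈ : ∀ {x j} → cross x j ≤ 1 → x ∈ S j
  cross≤1⇒∈ {x} {j} ≤1 with lookup (S j) x in eq
  ... | true = lookup⇒[]= x (S j) eq
  ... | false with s≤s () ← ≤1

  CentresCover⇒Coverable : ∀ s → CentresCover s → Coverable
  CentresCover⇒Coverable s cover =
    image centre , ≤-trans (∣image∣≤ centre) size≤k ,
    λ x → centre (cluster x) , ∈image centre (cluster x) , cover x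
    where open Solution s

  Coverable⇒CentresCover : Coverable → ∃[ s ] CentresCover s
  Coverable⇒CentresCover (J , ∣J∣≤k , cover) =
    record { size = ∣ J ∣ ; size≤k = ∣J∣≤k ; centre = enumerate J ; cluster = λ x → proj₁ (index x) } ,
    λ x → subst (λ j → x ∈ S j) (sym (proj₂ (index x))) (proj₂ (proj₂ (cover x)))
    where
    index : ∀ x → ∃[ i ] enumerate J i ≡ proj₁ (cover x)
    index x = enumerate-surjective (proj₁ (proj₂ (cover x)))

  -- Each client pays exactly 1 in s′ and at least 1 in s, while the total of s is no larger;
  -- `∑ℕ-tight` leaves no client of s paying more than 1.
  Optimal⇒CentresCover : ∀ {s s′} → Optimal s → CentresCover s′ → CentresCover s
  Optimal⇒CentresCover {s} {s′} optimal cover x = cross≤1⇒∈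
    (≤-trans (∑ℕ-tight (λ x → ≤-trans (≤-reflexive (∈⇒cross≡1 (cover x))) (1≤cross x _)) ∑≤∑ x)
             (≤-reflexive (∈⇒cross≡1 (cover x))))
    where
    ∑≤∑ : ∑ℕ (λ x → cross x (Solution.centre s (Solution.cluster s x))) ≤
          ∑ℕ (λ x → cross x (Solution.centre s′ (Solution.cluster s′ x)))
    ∑≤∑ = fromℕ-cancel-≤ (subst₂ ℚ._≤_ (cost≡ s) (cost≡ s′) (optimal s′))

-- Absorbing the overhead into the time bound

infixl 6 _⊞_

_⊞_ : List ℕ → List ℕ → List ℕ
[]      ⊞ q       = q
(a ∷ p) ⊞ []      = a ∷ p
(a ∷ p) ⊞ (b ∷ q) = a + b ∷ p ⊞ q

evalPoly-⊞ : ∀ p q x → evalPoly (p ⊞ q) x ≡ evalPoly p x + evalPoly q x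
evalPoly-⊞ []      q       x = refl
evalPoly-⊞ (a ∷ p) []      x = sym (+-identityʳ _)
evalPoly-⊞ (a ∷ p) (b ∷ q) x =
  trans (cong (λ r → a + b + x * r) (evalPoly-⊞ p q x)) (rearrange a b x _ _)
  where
  rearrange : ∀ a b x r s → a + b + x * (r + s) ≡ a + x * r + (b + x * s)
  rearrange = solve-∀

[m*n]^o≡m^o*n^o : ∀ m n o → (m * n) ^ o ≡ m ^ o * n ^ o
[m*n]^o≡m^o*n^o m n zero    = refl
[m*n]^o≡m^o*n^o m n (suc o) =
  trans (cong (m * n *_) ([m*n]^o≡m^o*n^o m n o)) ([m*n]*[o*p]≡[m*o]*[n*p] m n (m ^ o) (n ^ o))

1+n≤2^n : ∀ n → suc n ≤ 2 ^ n
1+n≤2^n zero    = ≤-refl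
1+n≤2^n (suc n) = begin
  suc (suc n)     ≤⟨ +-mono-≤ (s≤s z≤n) (1+n≤2^n n) ⟩
  suc n + 2 ^ n   ≤⟨ +-monoˡ-≤ (2 ^ n) (1+n≤2^n n) ⟩
  2 ^ n + 2 ^ n   ≡⟨ cong (2 ^ n +_) (sym (+-identityʳ (2 ^ n))) ⟩
  2 ^ suc n       ∎
  where open ≤-Reasoning

-- With q = n / 4 one has 1 + n ≤ 4(1 + q) ≤ 4 · 2^q, and 256 is 4^4. The fourth power arises
-- because an overhead quadratic in n is compared with 2^(n/2) by squaring.
[1+n]^4≤256*2^n : ∀ n → suc n ^ 4 ≤ 256 * 2 ^ n
[1+n]^4≤256*2^n n = begin
  suc n ^ 4                 ≤⟨ ^-monoˡ-≤ 4 1+n≤ ⟩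
  (4 * 2 ^ q) ^ 4           ≡⟨ [m*n]^o≡m^o*n^o 4 (2 ^ q) 4 ⟩
  256 * (2 ^ q) ^ 4         ≡⟨ cong (256 *_) (^-*-assoc 2 q 4) ⟩
  256 * 2 ^ (q * 4)         ≤⟨ *-monoʳ-≤ 256 (^-monoʳ-≤ 2 q*4≤n) ⟩
  256 * 2 ^ n               ∎
  where
  open ≤-Reasoning
  q = n / 4
  q*4≤n : q * 4 ≤ n
  q*4≤n = ≤-trans (m≤n+m (q * 4) (n % 4)) (≤-reflexive (sym (m≡m%n+[m/n]*n n 4)))
  1+n≤ : suc n ≤ 4 * 2 ^ q
  1+n≤ = begin
    suc n                  ≡⟨ cong suc (m≡m%n+[m/n]*n n 4) ⟩
    suc (n % 4) + q * 4    ≤⟨ +-monoˡ-≤ (q * 4) (m%n<n n 4) ⟩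
    4 + q * 4              ≡⟨ *-comm (suc q) 4 ⟩
    4 * suc q              ≤⟨ *-monoʳ-≤ 4 (1+n≤2^n q) ⟩
    4 * 2 ^ q              ∎

-- Per client the checking loop takes 3 steps, per table entry the filling loop takes 4.
overhead : ℕ → ℕ → ℕ
overhead n m = 8 + 3 * n + 4 * ((n + m) * (n + m))

-- Separates the variables: the factor in n goes into the exponential, the factor in m into the
-- polynomial.
overhead≤ : ∀ n m → overhead n m ≤ 8 * (suc n ^ 2 * suc m ^ 2)
overhead≤ n m = begin
  overhead n m
    ≤⟨ m≤m+n _ _ ⟩
  -- The added terms are exactly the difference of the two sides, which turns the estimate into a
  -- ring identity.
  overhead n m + (4 * n * n + 13 * n + 16 * m + 24 * n * m + 4 * m * m
    + 8 * n * n * m * m + 16 * n * m * m + 16 * n * n * m)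
    ≡⟨ identity n m ⟩
  8 * (suc n ^ 2 * suc m ^ 2) ∎
  where
  open ≤-Reasoning
  identity : ∀ n m → 8 + 3 * n + 4 * ((n + m) * (n + m)) + (4 * n * n + 13 * n + 16 * m + 24 * n * m + 4 * m * m
    + 8 * n * n * m * m + 16 * n * m * m + 16 * n * n * m)
    ≡ 8 * ((1 + n) * ((1 + n) * 1) * ((1 + m) * ((1 + m) * 1)))
  identity = solve-∀

-- The exponent 1/(2b) leaves a factor 2^(n/2) of slack for the overhead.
halfUnit : ℕ → ℚ
halfUnit b-1 = mkℚ (ℤ.+ 1) (b-1 + suc b-1) (Coprimality.1-coprimeTo _)

-- The product of C + 128 with p(m) + (1 + m)² dominates both C · p(m) and 128 · (1 + m)², the
-- coefficients of the solver and of the overhead. The 2 is the price of `bounded-+`, and 128² = 8²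
-- · 256.
totalC : ℕ → ℕ
totalC C = 2 * (C + 128)

totalPoly : List ℕ → List ℕ
totalPoly p = p ⊞ (1 ∷ 2 ∷ 1 ∷ [])

module _ (n b : ℕ) where

  -- `WithinTime` for ε = 1/(2b), with the coefficient C · p(m) abstracted to X: t ≤ X · 2^((1 -
  -- 1/(2b))n).
  Bounded : ℕ → ℕ → Set
  Bounded X t = t ^ (b + b) * 2 ^ n ≤ X ^ (b + b) * 2 ^ ((b + b) * n)

  ^-double : ∀ x → x ^ (b + b) ≡ (x ^ 2) ^ b
  ^-double x = trans (cong (λ c → x ^ (b + c)) (sym (+-identityʳ b))) (sym (^-*-assoc x 2 b))

  bounded-mono : ∀ {X Y s t} → X ≤ Y → s ≤ t → Bounded X t → Bounded Y s
  bounded-mono X≤Y s≤t p =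
    ≤-trans (*-monoˡ-≤ (2 ^ n) (^-monoˡ-≤ (b + b) s≤t))
            (≤-trans p (*-monoˡ-≤ (2 ^ ((b + b) * n)) (^-monoˡ-≤ (b + b) X≤Y)))

  bounded-double : ∀ {X t} → Bounded X t → Bounded (2 * X) (2 * t)
  bounded-double {X} {t} p = subst₂ _≤_ (pull t (2 ^ n)) (pull X _) (*-monoʳ-≤ (2 ^ (b + b)) p)
    where
    pull : ∀ x z → 2 ^ (b + b) * (x ^ (b + b) * z) ≡ (2 * x) ^ (b + b) * z
    pull x z = trans (sym (*-assoc (2 ^ (b + b)) (x ^ (b + b)) z))
                     (cong (_* z) (sym ([m*n]^o≡m^o*n^o 2 x (b + b))))

  -- The bound is stated for powers, which do not distribute over sums; so the larger summand is
  -- doubled instead.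
  bounded-+ : ∀ {X Y s t} → Bounded X s → Bounded Y t → Bounded (2 * (X + Y)) (s + t)
  bounded-+ {X} {Y} {s} {t} p q with ≤-total s t
  ... | inj₁ s≤t = bounded-mono (*-monoʳ-≤ 2 (m≤n+m Y X)) s+t≤2t (bounded-double q)
    where
    s+t≤2t : s + t ≤ 2 * t
    s+t≤2t = ≤-trans (+-monoˡ-≤ t s≤t) (≤-reflexive (cong (t +_) (sym (+-identityʳ t))))
  ... | inj₂ t≤s = bounded-mono (*-monoʳ-≤ 2 (m≤m+n X Y)) s+t≤2s (bounded-double p)
    where
    s+t≤2s : s + t ≤ 2 * s
    s+t≤2s = ≤-trans (+-monoʳ-≤ s t≤s) (≤-reflexive (cong (s +_) (sym (+-identityʳ s))))

  -- The hypothesis is t ≤ X · 2^(n/2), squared to keep exponents integral, and 1/2 ≤ 1 - 1/(2b) as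
  -- soon as b ≥ 1.
  bounded-square : ∀ {X t} → 1 ≤ b → t ^ 2 ≤ X ^ 2 * 2 ^ n → Bounded X t
  bounded-square {X} {t} 1≤b p = begin
    t ^ (b + b) * 2 ^ n                     ≡⟨ cong (_* 2 ^ n) (^-double t) ⟩
    (t ^ 2) ^ b * 2 ^ n                     ≤⟨ *-monoˡ-≤ (2 ^ n) (^-monoˡ-≤ b p) ⟩
    (X ^ 2 * 2 ^ n) ^ b * 2 ^ n             ≡⟨ cong (_* 2 ^ n) ([m*n]^o≡m^o*n^o (X ^ 2) (2 ^ n) b) ⟩
    (X ^ 2) ^ b * (2 ^ n) ^ b * 2 ^ n       ≡⟨ *-assoc ((X ^ 2) ^ b) ((2 ^ n) ^ b) (2 ^ n) ⟩
    (X ^ 2) ^ b * ((2 ^ n) ^ b * 2 ^ n)     ≡⟨ cong₂ _*_ (sym (^-double X)) exponents ⟩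
    X ^ (b + b) * 2 ^ (n * b + n)           ≤⟨ *-monoʳ-≤ (X ^ (b + b)) (^-monoʳ-≤ 2 exponent≤) ⟩
    X ^ (b + b) * 2 ^ ((b + b) * n)         ∎
    where
    open ≤-Reasoning
    exponents : (2 ^ n) ^ b * 2 ^ n ≡ 2 ^ (n * b + n)
    exponents = trans (cong (_* 2 ^ n) (^-*-assoc 2 n b)) (sym (^-distribˡ-+-* 2 (n * b) n))
    exponent≤ : n * b + n ≤ (b + b) * n
    exponent≤ = begin
      n * b + n      ≡⟨ cong₂ _+_ (*-comm n b) (sym (*-identityˡ n)) ⟩
      b * n + 1 * n  ≤⟨ +-monoʳ-≤ (b * n) (*-monoˡ-≤ n 1≤b) ⟩
      b * n + b * n  ≡⟨ sym (*-distribʳ-+ n b b) ⟩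
      (b + b) * n    ∎

  -- Squaring the hypothesis brings the exponent b to 2b and yields a factor 2^(2an), of which 2^n
  -- is kept.
  bounded-weaken : ∀ {X t} a → 1 ≤ a → t ^ b * 2 ^ (a * n) ≤ X ^ b * 2 ^ (b * n) → Bounded X t
  bounded-weaken {X} {t} a 1≤a p = begin
    t ^ (b + b) * 2 ^ n
      ≤⟨ *-monoʳ-≤ (t ^ (b + b)) (^-monoʳ-≤ 2 n≤) ⟩
    t ^ (b + b) * 2 ^ (a * n + a * n)
      ≡⟨ square t (a * n) ⟩
    (t ^ b * 2 ^ (a * n)) * (t ^ b * 2 ^ (a * n))
      ≤⟨ *-mono-≤ p p ⟩
    (X ^ b * 2 ^ (b * n)) * (X ^ b * 2 ^ (b * n))
      ≡⟨ sym (square X (b * n)) ⟩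
    X ^ (b + b) * 2 ^ (b * n + b * n)
      ≡⟨ cong (λ e → X ^ (b + b) * 2 ^ e) (sym (*-distribʳ-+ n b b)) ⟩
    X ^ (b + b) * 2 ^ ((b + b) * n) ∎
    where
    open ≤-Reasoning
    n≤ : n ≤ a * n + a * n
    n≤ = ≤-trans (≤-trans (≤-reflexive (sym (*-identityˡ n))) (*-monoˡ-≤ n 1≤a)) (m≤m+n (a * n) (a * n))
    square : ∀ x e → x ^ (b + b) * 2 ^ (e + e) ≡ (x ^ b * 2 ^ e) * (x ^ b * 2 ^ e)
    square x e = trans (cong₂ _*_ (^-distribˡ-+-* x b b) (^-distribˡ-+-* 2 e e))
                       ([m*n]*[o*p]≡[m*o]*[n*p] (x ^ b) (x ^ b) (2 ^ e) (2 ^ e))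

overhead²≤ : ∀ n m → overhead n m ^ 2 ≤ (128 * suc m ^ 2) ^ 2 * 2 ^ n
overhead²≤ n m = begin
  overhead n m ^ 2                          ≤⟨ ^-monoˡ-≤ 2 (overhead≤ n m) ⟩
  (8 * (suc n ^ 2 * suc m ^ 2)) ^ 2         ≡⟨ identity₁ n m ⟩
  64 * suc m ^ 4 * suc n ^ 4                ≤⟨ *-monoʳ-≤ (64 * suc m ^ 4) ([1+n]^4≤256*2^n n) ⟩
  64 * suc m ^ 4 * (256 * 2 ^ n)            ≡⟨ identity₂ m (2 ^ n) ⟩
  (128 * suc m ^ 2) ^ 2 * 2 ^ n             ∎
  where
  open ≤-Reasoning
  identity₁ : ∀ n m → (8 * (suc n ^ 2 * suc m ^ 2)) ^ 2 ≡ 64 * suc m ^ 4 * suc n ^ 4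
  identity₁ n m = unfolded (suc n) (suc m)
    where
    unfolded : ∀ x y → 8 * (x * (x * 1) * (y * (y * 1))) * (8 * (x * (x * 1) * (y * (y * 1))) * 1)
             ≡ 64 * (y * (y * (y * (y * 1)))) * (x * (x * (x * (x * 1))))
    unfolded = solve-∀
  identity₂ : ∀ m z → 64 * suc m ^ 4 * (256 * z) ≡ (128 * suc m ^ 2) ^ 2 * z
  identity₂ m = unfolded (suc m)
    where
    unfolded : ∀ y z → 64 * (y * (y * (y * (y * 1)))) * (256 * z)
             ≡ 128 * (y * (y * 1)) * (128 * (y * (y * 1)) * 1) * z
    unfolded = solve-∀

positive⇒1≤∣↥∣ : ∀ {ε} → 0ℚ ℚ.< ε → 1 ≤ ℤ.∣ ℚ.numerator ε ∣
positive⇒1≤∣↥∣ {mkℚ (ℤ.+ zero)  _ _} (ℚ.*<* (ℤ.+<+ ()))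
positive⇒1≤∣↥∣ {mkℚ (ℤ.+ suc _) _ _} _ = s≤s z≤n
positive⇒1≤∣↥∣ {mkℚ ℤ.-[1+ _ ]  _ _} _ = s≤s z≤n

within-total : ∀ {ε} → 0ℚ ℚ.< ε → ∀ C p n m {t T} →
  WithinTime ε C p n m t → T ≤ t + overhead n m →
  WithinTime (halfUnit (ℚ.denominator-1 ε)) (totalC C) (totalPoly p) n m T
within-total {ε} 0<ε C p n m {t} {T} within T≤ =
  subst (λ e → T ^ (b + b) * 2 ^ e ≤ X ^ (b + b) * 2 ^ ((b + b) * n)) (sym (*-identityˡ n))
    (bounded-mono n b {t = t + overhead n m} bound T≤
      (bounded-+ n b {C * A} {128 * suc m ^ 2} {t} {overhead n m} main over))
  where
  a = ℤ.∣ ℚ.numerator ε ∣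
  b = suc (ℚ.denominator-1 ε)
  X = totalC C * evalPoly (totalPoly p) m
  A = evalPoly p m

  main : Bounded n b (C * A) t
  main = bounded-weaken n b {C * A} {t} a (positive⇒1≤∣↥∣ 0<ε) within

  over : Bounded n b (128 * suc m ^ 2) (overhead n m)
  over = bounded-square n b {128 * suc m ^ 2} (s≤s z≤n) (overhead²≤ n m)

  bound : 2 * (C * evalPoly p m + 128 * suc m ^ 2) ≤ X
  bound = begin
    -- The added terms are the mixed products in the expansion of (C + 128) · (A + (1 + m)²).
    2 * (C * A + 128 * suc m ^ 2)              ≤⟨ m≤m+n _ (2 * (C * suc m ^ 2 + 128 * A)) ⟩
    2 * (C * A + 128 * suc m ^ 2) + 2 * (C * suc m ^ 2 + 128 * A)
                                               ≡⟨ identity C A m ⟩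
    totalC C * (A + evalPoly (1 ∷ 2 ∷ 1 ∷ []) m) ≡⟨ cong (totalC C *_) (sym (evalPoly-⊞ p _ m)) ⟩
    X                                          ∎
    where
    open ≤-Reasoning
    identity : ∀ C A m → 2 * (C * A + 128 * ((1 + m) * ((1 + m) * 1))) + 2 * (C * ((1 + m) * ((1 + m) * 1)) + 128 * A)
      ≡ 2 * (C + 128) * (A + (1 + m * (2 + m * (1 + m * 0))))
    identity = solve-∀

-- Row-major tables and partially filled arrays

index< : ∀ {a b i j} → i ℕ.< a → j ℕ.< b → b * i + j ℕ.< a * b
index< {a} {b} {i} {j} i<a j<b = begin-strict
  b * i + j    <⟨ +-monoʳ-< (b * i) j<b ⟩
  b * i + b    ≡⟨ trans (+-comm (b * i) b) (sym (*-suc b i)) ⟩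
  b * suc i    ≤⟨ *-monoʳ-≤ b i<a ⟩
  b * a        ≡⟨ *-comm b a ⟩
  a * b        ∎
  where open ≤-Reasoning

table-outside : ∀ {a b} (f : Fin a → Fin b → ℕ) {i} → ¬ i ℕ.< a * b → table f i ≡ 0
table-outside {a} {b} f {i} i≮ab with i <? a * b
... | yes i<ab = contradiction i<ab i≮ab
... | no  _    = refl

table-combine : ∀ {a b} (f : Fin a → Fin b → ℕ) u v → table f (b * toℕ u + toℕ v) ≡ f u v
table-combine {a} {b} f u v with b * toℕ u + toℕ v <? a * b
... | no  ≮    = contradiction (index< (toℕ<n u) (toℕ<n v)) ≮
... | yes i<ab = trans
  (cong (λ i → uncurry f (remQuot b i)) (toℕ-injective (trans (toℕ-fromℕ< i<ab) (sym (toℕ-combine u v)))))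
  (cong (uncurry f) (remQuot-combine u v))

table-≤ : ∀ {a b} {f : Fin a → Fin b → ℕ} {B} → (∀ u v → f u v ≤ B) → ∀ i → table f i ≤ B
table-≤ {a} {b} f≤B i with i <? a * b
... | yes i<ab = f≤B _ _
... | no  _    = z≤n

position : ∀ {a b i} → i ℕ.< a * b → ∃[ u ] ∃[ v ] i ≡ b * toℕ u + toℕ {b} v
position {a} {b} i<ab =
  let u , v , eq = combine-surjective {a} {b} (fromℕ< i<ab)
  in u , v , trans (sym (toℕ-fromℕ< i<ab)) (trans (cong toℕ (sym eq)) (toℕ-combine u v))

[b*u+v]/b≡u : ∀ b .{{_ : NonZero b}} u {v} → v ℕ.< b → (b * u + v) / b ≡ u
[b*u+v]/b≡u b u {v} v<b = begin
  (b * u + v) / b      ≡⟨ +-distrib-/-∣ˡ v (m∣m*n u) ⟩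
  b * u / b + v / b    ≡⟨ cong₂ _+_ (trans (cong (_/ b) (*-comm b u)) (m*n/n≡m u b)) (m<n⇒m/n≡0 v<b) ⟩
  u + 0                ≡⟨ +-identityʳ u ⟩
  u                    ∎
  where open ≡-Reasoning

[b*u+v]%b≡v : ∀ b .{{_ : NonZero b}} u {v} → v ℕ.< b → (b * u + v) % b ≡ v
[b*u+v]%b≡v b u {v} v<b = trans
  (cong (_% b) (trans (+-comm (b * u) v) (cong (v +_) (*-comm b u))))
  (trans ([m+kn]%n≡m%n v u b) (m<n⇒m%n≡m v<b))

prefix : ℕ → (ℕ → ℕ) → ℕ → ℕ
prefix i f j = if does (j <? i) then f j else 0

prefix-< : ∀ f {i j} → j ℕ.< i → prefix i f j ≡ f j
prefix-< f {i} {j} j<i = cong (if_then f j else 0) (dec-true (j <? i) j<i)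

prefix-≥ : ∀ f {i j} → ¬ j ℕ.< i → prefix i f j ≡ 0
prefix-≥ f {i} {j} j≮i = cong (if_then f j else 0) (dec-false (j <? i) j≮i)

-- The left side is what a store update at index i unfolds to.
prefix-suc : ∀ i f j → (if does (i ≟ j) then f i else prefix i f j) ≡ prefix (suc i) f j
prefix-suc i f j with i ≟ j
... | yes refl = trans (cong (if_then f i else prefix i f i) (dec-true (i ≟ i) refl))
                       (sym (prefix-< f (n<1+n i)))
... | no  i≢j  = trans (cong (if_then f i else prefix i f j) (dec-false (i ≟ j) i≢j)) (unchanged (j <? i))
  where
  unchanged : Dec (j ℕ.< i) → prefix i f j ≡ prefix (suc i) f j
  unchanged (yes j<i) = trans (prefix-< f j<i) (sym (prefix-< f (m≤n⇒m≤1+n j<i)))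
  unchanged (no  j≮i) = trans (prefix-≥ f j≮i)
    (sym (prefix-≥ f λ j<1+i → i≢j (≤-antisym (≮⇒≥ j≮i) (≤-pred j<1+i))))

-- `Relocated` compares arrays at all indices, also beyond the table; there both sides are 0.
prefix-all : ∀ {i f} → (∀ {j} → ¬ j ℕ.< i → f j ≡ 0) → ∀ j → prefix i f j ≡ f j
prefix-all {i} {f} zeros j with j <? i
... | yes j<i = prefix-< f j<i
... | no  j≮i = trans (prefix-≥ f j≮i) (sym (zeros j≮i))

-- The reduction as a program

-- Array 2 holds the next table entry to fill, the next client to check, and the verdict so far;
-- the input of the relocated k-median program is in arrays 3 to 5 and its answer in 6 to 8.
n̂ m̂ k̂ N̂ entry client : Expr
n̂      = get 0 (lit 0)
m̂      = get 0 (lit 1)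
k̂      = get 0 (lit 2)
N̂      = n̂ +ᵉ m̂
entry  = get 2 (lit 0)
client = get 2 (lit 1)

-- Points are numbered as by `point`, clients before facilities, so the truncated difference
-- `n̂ -ᵉ u` is nonzero exactly for clients. The sum of the two truncated differences in `discreteᵉ`
-- is the absolute difference.
memberᵉ discreteᵉ crossᵉ distᵉ : Expr → Expr → Expr
memberᵉ x j   = get 1 (m̂ *ᵉ x +ᵉ j)
discreteᵉ u v = select ((u -ᵉ v) +ᵉ (v -ᵉ u)) (lit 2) (lit 0)
crossᵉ x j    = lit 3 -ᵉ lit 2 *ᵉ memberᵉ x j
distᵉ u v     = select (n̂ -ᵉ u)
  (select (n̂ -ᵉ v) (discreteᵉ u v) (crossᵉ u (v -ᵉ n̂)))
  (select (n̂ -ᵉ v) (crossᵉ v (u -ᵉ n̂)) (discreteᵉ u v))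

copyScalars fillTables checkCentres : Program
copyScalars = put 3 (lit 0) n̂ ⨾ put 3 (lit 1) m̂ ⨾ put 3 (lit 2) k̂
fillTables = while (N̂ *ᵉ N̂ -ᵉ entry)
  ( put 4 entry (distᵉ (entry /ᵉ N̂) (entry %ᵉ N̂))
  ⨾ put 5 entry (lit 1)
  ⨾ put 2 (lit 0) (entry +ᵉ lit 1))
checkCentres = while (n̂ -ᵉ client)
  -- An arbitrary word of m or more would point outside the client's row of the membership table; it
  -- counts as not covered. A nonzero verdict thus exhibits a facility for every client.
  ( put 2 (lit 2) (get 2 (lit 2) *ᵉ select (m̂ -ᵉ centre) (memberᵉ client centre) (lit 0))
  ⨾ put 2 (lit 1) (client +ᵉ lit 1))
  where
  centre : Expr
  centre = get 7 (get 8 client)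

-- `KMedianInstance` demands a positive k. For k = 0 the empty family covers only the empty
-- universe, and the truncated difference 1 - n is the answer.
decideCover : Program → Program
decideCover solve = cond k̂
  ( copyScalars ⨾ fillTables ⨾ relocate solve
  ⨾ put 2 (lit 2) (lit 1) ⨾ checkCentres ⨾ put 0 (lit 0) (get 2 (lit 2)))
  (put 0 (lit 0) (lit 1 -ᵉ n̂))

points : SetCoverInstance → ℕ
points I = SetCoverInstance.n I + SetCoverInstance.m I

-- Running the reduction

module Execution (I : SetCoverInstance) (0<k : 0 ℕ.< SetCoverInstance.k I) (w : ℕ)
  (3<2^w : 3 ℕ.< 2 ^ w)
  (N<2^w : points I ℕ.< 2 ^ w) (N²<2^w : points I * points I ℕ.< 2 ^ w) where

  open SetCoverInstance I
  open Reduction I 0<k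
  open KMedianInstance kMedian using (point)
  open WordRAM w (<-trans (s≤s (s≤s z≤n)) 3<2^w)

  N : ℕ
  N = points I

  1<2^w : 1 ℕ.< 2 ^ w
  1<2^w = <-trans (s≤s (s≤s z≤n)) 3<2^w

  2<2^w : 2 ℕ.< 2 ^ w
  2<2^w = <-trans (s≤s (s≤s (s≤s z≤n))) 3<2^w

  n<2^w : n ℕ.< 2 ^ w
  n<2^w = ≤-<-trans (m≤m+n n m) N<2^w

  m<2^w : m ℕ.< 2 ^ w
  m<2^w = ≤-<-trans (m≤n+m m n) N<2^w

  members : ℕ → ℕ
  members = table λ (x : Fin n) (j : Fin m) → bit (lookup (S j) x)

  bit≤1 : ∀ b → bit b ≤ 1
  bit≤1 true  = ≤-refl
  bit≤1 false = z≤n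

  members≤1 : ∀ i → members i ≤ 1
  members≤1 = table-≤ λ x j → bit≤1 (lookup (S j) x)

  HoldsInput : Store → Set
  HoldsInput σ = (∀ i → σ 0 i ≡ scalars n m k i) × (∀ i → σ 1 i ≡ members i)

  rank : Fin n ⊎ Fin m → ℕ
  rank (inj₁ x) = toℕ x
  rank (inj₂ j) = n + toℕ j

  rank<2^w : ∀ p → rank p ℕ.< 2 ^ w
  rank<2^w (inj₁ x) = <-trans (toℕ<n x) n<2^w
  rank<2^w (inj₂ j) = <-trans (+-monoʳ-< n (toℕ<n j)) N<2^w

  client≢0 : ∀ (x : Fin n) → n ∸ toℕ x ≢ 0
  client≢0 x = m>n⇒m∸n≢0 (toℕ<n x)

  module _ {σ : Store} (holds : HoldsInput σ) where

    ⇓n : σ ⊢ n̂ ⇓ n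
    ⇓n = ⇓-get (⇓-lit 0<2^w) (proj₁ holds 0)

    ⇓m : σ ⊢ m̂ ⇓ m
    ⇓m = ⇓-get (⇓-lit 1<2^w) (proj₁ holds 1)

    ⇓k : σ ⊢ k̂ ⇓ k
    ⇓k = ⇓-get (⇓-lit 2<2^w) (proj₁ holds 2)

    ⇓N : σ ⊢ N̂ ⇓ N
    ⇓N = ⇓-+ ⇓n ⇓m N<2^w

    ⇓member : ∀ {x̂ ĵ x j} → σ ⊢ x̂ ⇓ x → σ ⊢ ĵ ⇓ j → x ℕ.< n → j ℕ.< m →
              σ ⊢ memberᵉ x̂ ĵ ⇓ members (m * x + j)
    ⇓member {x = x} {j} ⇓x ⇓j x<n j<m =
      ⇓-get (⇓-+ (⇓-* ⇓m ⇓x (≤-<-trans (m≤m+n (m * x) j) index<2^w)) ⇓j index<2^w) (proj₂ holds _)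
      where
      index<2^w : m * x + j ℕ.< 2 ^ w
      index<2^w = <-trans (<-≤-trans (index< x<n j<m) (*-mono-≤ (m≤m+n n m) (m≤n+m m n))) N²<2^w

    ⇓cross : ∀ {x̂ ĵ} x j → σ ⊢ x̂ ⇓ toℕ x → σ ⊢ ĵ ⇓ toℕ j → σ ⊢ crossᵉ x̂ ĵ ⇓ cross x j
    ⇓cross x j ⇓x ⇓j =
      ⇓-∸ (⇓-lit 3<2^w)
          (⇓-* (⇓-lit 2<2^w) ⇓member′ (≤-<-trans (*-monoʳ-≤ 2 (bit≤1 (lookup (S j) x))) 2<2^w))
          3<2^w
      where
      ⇓member′ = subst (_ ⊢ _ ⇓_) (table-combine (λ x j → bit (lookup (S j) x)) x j)
                       (⇓member ⇓x ⇓j (toℕ<n x) (toℕ<n j))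

    -- The machine numbers u′ and v′ are kept apart from u and v because clients are represented by
    -- `toℕ` and facilities by `toℕ` shifted by n.
    ⇓discrete : ∀ {l û v̂ u′ v′} (u v : Fin l) →
      σ ⊢ û ⇓ u′ → σ ⊢ v̂ ⇓ v′ → u′ ℕ.< 2 ^ w → v′ ℕ.< 2 ^ w →
      (u ≡ v → u′ ≡ v′) → (u′ ≡ v′ → u ≡ v) → σ ⊢ discreteᵉ û v̂ ⇓ discrete u v
    ⇓discrete {u′ = u′} {v′} u v ⇓u ⇓v u′< v′< to from with discrete-cases u v
    ... | inj₁ (u≡v , ≡0) with refl ← to u≡v rewrite ≡0 =
      ⇓-select-zero
        (⇓-bin ⊕ (⇓-∸ ⇓u ⇓v u′<) (⇓-∸ ⇓v ⇓u v′<) (cong₂ _+_ (n∸n≡0 u′) (n∸n≡0 u′)) 0<2^w)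
        (⇓-lit 0<2^w) 0<2^w
    ... | inj₂ (u≢v , ≡2) rewrite ≡2 =
      ⇓-select-suc (⇓-+ (⇓-∸ ⇓u ⇓v u′<) (⇓-∸ ⇓v ⇓u v′<) ∣u-v∣<2^w)
        (λ ≡0 → u≢v (from (≤-antisym (m∸n≡0⇒m≤n (m+n≡0⇒m≡0 (u′ ∸ v′) ≡0))
                                     (m∸n≡0⇒m≤n (m+n≡0⇒n≡0 (u′ ∸ v′) ≡0)))))
        (⇓-lit 2<2^w) 2<2^w
      where
      ∣u-v∣<2^w : u′ ∸ v′ + (v′ ∸ u′) ℕ.< 2 ^ w
      ∣u-v∣<2^w with ≤-total u′ v′
      ... | inj₁ u≤v rewrite m≤n⇒m∸n≡0 u≤v = ≤-<-trans (m∸n≤m v′ u′) v′<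
      ... | inj₂ v≤u rewrite m≤n⇒m∸n≡0 v≤u | +-identityʳ (u′ ∸ v′) = ≤-<-trans (m∸n≤m u′ v′) u′<

    ⇓client : ∀ {û} x → σ ⊢ û ⇓ toℕ x → σ ⊢ n̂ -ᵉ û ⇓ n ∸ toℕ {n} x
    ⇓client x ⇓u = ⇓-∸ ⇓n ⇓u n<2^w

    ⇓facility : ∀ {û} (j : Fin m) → σ ⊢ û ⇓ n + toℕ j → σ ⊢ n̂ -ᵉ û ⇓ 0
    ⇓facility j ⇓u = ⇓-bin ⊖ ⇓n ⇓u (m≤n⇒m∸n≡0 (m≤m+n n (toℕ j))) 0<2^w

    ⇓offset : ∀ {û} (j : Fin m) → σ ⊢ û ⇓ n + toℕ j → σ ⊢ û -ᵉ n̂ ⇓ toℕ j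
    ⇓offset j ⇓u = ⇓-bin ⊖ ⇓u ⇓n (m+n∸m≡n n (toℕ j)) (<-trans (toℕ<n j) m<2^w)

    ⇓dist : ∀ {û v̂} p q → σ ⊢ û ⇓ rank p → σ ⊢ v̂ ⇓ rank q → σ ⊢ distᵉ û v̂ ⇓ dist p q
    ⇓dist p q ⇓u ⇓v with ≤-<-trans (dist≤3 p q) 3<2^w
    ⇓dist (inj₁ x) (inj₁ y) ⇓u ⇓v | d<2^w =
      ⇓-select-suc (⇓client x ⇓u) (client≢0 x)
        (⇓-select-suc (⇓client y ⇓v) (client≢0 y)
          (⇓discrete x y ⇓u ⇓v (rank<2^w (inj₁ x)) (rank<2^w (inj₁ y)) (cong toℕ) toℕ-injective)
          d<2^w)
        d<2^w
    ⇓dist (inj₁ x) (inj₂ j) ⇓u ⇓v | d<2^w =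
      ⇓-select-suc (⇓client x ⇓u) (client≢0 x)
        (⇓-select-zero (⇓facility j ⇓v) (⇓cross x j ⇓u (⇓offset j ⇓v)) d<2^w) d<2^w
    ⇓dist (inj₂ i) (inj₁ y) ⇓u ⇓v | d<2^w =
      ⇓-select-zero (⇓facility i ⇓u)
        (⇓-select-suc (⇓client y ⇓v) (client≢0 y) (⇓cross y i ⇓v (⇓offset i ⇓u)) d<2^w) d<2^w
    ⇓dist (inj₂ i) (inj₂ j) ⇓u ⇓v | d<2^w =
      ⇓-select-zero (⇓facility i ⇓u)
        (⇓-select-zero (⇓facility j ⇓v)
          (⇓discrete i j ⇓u ⇓v (rank<2^w (inj₂ i)) (rank<2^w (inj₂ j))
            (cong (λ i → n + toℕ i)) (λ eq → toℕ-injective (+-cancelˡ-≡ n _ _ eq)))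
          d<2^w)
        d<2^w

  toℕ-point : ∀ u → rank (point u) ≡ toℕ u
  toℕ-point u = trans (helper (splitAt n u)) (cong toℕ (join-splitAt n m u))
    where
    helper : ∀ p → rank ([ inj₁ , inj₂ ] p) ≡ toℕ (join n m p)
    helper (inj₁ x) = sym (toℕ-↑ˡ x m)
    helper (inj₂ j) = sym (toℕ-↑ʳ n j)

  distances denominators : ℕ → ℕ
  distances    = table λ (u v : Fin N) → dist (point u) (point v)
  denominators = table λ (u v : Fin N) → 1

  -- The entire store after i rounds of filling, as an invariant. Everything from array 6 on is
  -- still 0, as the solver expects of its own arrays, and so is the client counter in array 2.
  partial : ℕ → Store
  partial i 0 = scalars n m k
  partial i 1 = members
  partial i 2 zero    = i
  partial i 2 (suc _) = 0
  partial i 3 = scalars n m k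
  partial i 4 = prefix i distances
  partial i 5 = prefix i denominators
  partial i _ = λ _ → 0

  _≈_ : Store → Store → Set
  σ ≈ τ = ∀ a i → σ a i ≡ τ a i

  partial-holds : ∀ {i σ} → σ ≈ partial i → HoldsInput σ
  partial-holds σ≈ = σ≈ 0 , σ≈ 1

  fill-step : ∀ {cs i σ} → i ℕ.< N * N → σ ≈ partial i →
    Halts ( put 4 entry (distᵉ (entry /ᵉ N̂) (entry %ᵉ N̂))
          ⨾ put 5 entry (lit 1)
          ⨾ put 2 (lit 0) (entry +ᵉ lit 1))
          σ cs 3 (_≈ partial (suc i))
  fill-step {cs} {i} {σ} i<N² σ≈ with u , v , i≡ ← position {N} {N} i<N² =
    3 , σ₃ ,
    seq (run-put ⇓i ⇓d) (seq (run-put ⇓i₁ (⇓-lit 1<2^w)) (run-put (⇓-lit 0<2^w) (⇓-+ ⇓i₂ (⇓-lit 1<2^w) 1+i<2^w))) ,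
    ≤-refl , σ₃≈
    where
    σ₁ = σ [ 4 , i ≔ distances i ]
    σ₂ = σ₁ [ 5 , i ≔ 1 ]
    σ₃ = σ₂ [ 2 , 0 ≔ i + 1 ]
    i<2^w : i ℕ.< 2 ^ w
    i<2^w = <-trans i<N² N²<2^w
    1+i<2^w : i + 1 ℕ.< 2 ^ w
    1+i<2^w = subst (ℕ._< 2 ^ w) (+-comm 1 i) (≤-<-trans i<N² N²<2^w)
    ⇓i : σ ⊢ entry ⇓ i
    ⇓i = ⇓-get (⇓-lit 0<2^w) (σ≈ 2 0)
    ⇓i₁ : σ₁ ⊢ entry ⇓ i
    ⇓i₁ = ⇓-get (⇓-lit 0<2^w) (σ≈ 2 0)
    ⇓i₂ : σ₂ ⊢ entry ⇓ i
    ⇓i₂ = ⇓-get (⇓-lit 0<2^w) (σ≈ 2 0)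
    instance
      N≢0 : NonZero N
      N≢0 = ℕ.>-nonZero (≤-<-trans z≤n (toℕ<n u))
    ⇓u : σ ⊢ entry /ᵉ N̂ ⇓ rank (point u)
    ⇓u = subst (σ ⊢ _ ⇓_)
      (trans (cong (_/ N) i≡) (trans ([b*u+v]/b≡u N (toℕ u) (toℕ<n v)) (sym (toℕ-point u))))
      (⇓-/ ⇓i (⇓N (partial-holds σ≈)) i<2^w)
    ⇓v : σ ⊢ entry %ᵉ N̂ ⇓ rank (point v)
    ⇓v = subst (σ ⊢ _ ⇓_)
      (trans (cong (_% N) i≡) (trans ([b*u+v]%b≡v N (toℕ u) (toℕ<n v)) (sym (toℕ-point v))))
      (⇓-% ⇓i (⇓N (partial-holds σ≈)) i<2^w)
    ⇓d : σ ⊢ distᵉ (entry /ᵉ N̂) (entry %ᵉ N̂) ⇓ distances i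
    ⇓d = subst (σ ⊢ _ ⇓_)
      (sym (trans (cong distances i≡) (table-combine (λ u v → dist (point u) (point v)) u v)))
      (⇓dist (partial-holds σ≈) (point u) (point v) ⇓u ⇓v)
    denominators≡1 : denominators i ≡ 1
    denominators≡1 = trans (cong denominators i≡) (table-combine (λ _ _ → 1) u v)
    σ₃≈ : σ₃ ≈ partial (suc i)
    σ₃≈ 0 j = σ≈ 0 j
    σ₃≈ 1 j = σ≈ 1 j
    σ₃≈ 2 zero = +-comm i 1
    σ₃≈ 2 (suc j) = σ≈ 2 (suc j)
    σ₃≈ 3 j = σ≈ 3 j
    σ₃≈ 4 j = trans (cong (if does (i ≟ j) then distances i else_) (σ≈ 4 j)) (prefix-suc i distances j)
    σ₃≈ 5 j = trans (cong₂ (λ x y → if does (i ≟ j) then x else y) (sym denominators≡1) (σ≈ 5 j))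
                    (prefix-suc i denominators j)
    σ₃≈ (suc (suc (suc (suc (suc (suc a)))))) j = σ≈ (6 + a) j

  run-fillTables : ∀ {cs σ} → σ ≈ partial 0 →
    Halts fillTables σ cs (1 + N * N * 4) (_≈ partial (N * N))
  run-fillTables = while-halts (λ i → _≈ partial i)
    (λ σ≈ → ⇓-∸ (⇓-* (⇓N (partial-holds σ≈)) (⇓N (partial-holds σ≈)) N²<2^w)
                (⇓-get (⇓-lit 0<2^w) (σ≈ 2 0)) N²<2^w)
    fill-step (N * N) refl

  run-copyScalars : ∀ {cs} → Halts copyScalars input cs 3 (_≈ partial 0)
  run-copyScalars = 3 , _ ,
    seq (run-put (⇓-lit 0<2^w) (⇓n ((λ _ → refl) , (λ _ → refl))))
      (seq (run-put (⇓-lit 1<2^w) (⇓m ((λ _ → refl) , (λ _ → refl))))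
           (run-put (⇓-lit 2<2^w) (⇓k ((λ _ → refl) , (λ _ → refl))))) ,
    ≤-refl , σ≈
    where
    σ≈ : (((input [ 3 , 0 ≔ n ]) [ 3 , 1 ≔ m ]) [ 3 , 2 ≔ k ]) ≈ partial 0
    σ≈ 0 j = refl
    σ≈ 1 j = refl
    σ≈ 2 zero = refl
    σ≈ 2 (suc j) = refl
    σ≈ 3 0 = refl
    σ≈ 3 1 = refl
    σ≈ 3 2 = refl
    σ≈ 3 (suc (suc (suc j))) = refl
    σ≈ 4 j = refl
    σ≈ 5 j = refl
    σ≈ (suc (suc (suc (suc (suc (suc a)))))) j = refl

  partial-relocates : ∀ {σ} → σ ≈ partial (N * N) → Relocated (KMedianInstance.input kMedian) σ
  partial-relocates σ≈ 0 j = σ≈ 3 j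
  partial-relocates σ≈ 1 j = trans (σ≈ 4 j) (prefix-all {N * N} {distances} (table-outside {N} {N} _) j)
  partial-relocates σ≈ 2 j = trans (σ≈ 5 j) (prefix-all {N * N} {denominators} (table-outside {N} {N} _) j)
  partial-relocates σ≈ (suc (suc (suc a))) j = σ≈ (6 + a) j

  covered : Store → ℕ → ℕ
  covered σ x = if does (σ 4 (σ 5 x) <? m) then members (m * x + σ 4 (σ 5 x)) else 0

  covered≤1 : ∀ σ x → covered σ x ≤ 1
  covered≤1 σ x with does (σ 4 (σ 5 x) <? m)
  ... | true  = members≤1 (m * x + σ 4 (σ 5 x))
  ... | false = z≤n

  allCovered : Store → ℕ → ℕ
  allCovered σ zero    = 1
  allCovered σ (suc x) = allCovered σ x * covered σ x

  allCovered≤1 : ∀ σ x → allCovered σ x ≤ 1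
  allCovered≤1 σ zero    = ≤-refl
  allCovered≤1 σ (suc x) = *-mono-≤ (allCovered≤1 σ x) (covered≤1 σ x)

  module _ {σ : Store} where

    record Checked (x : ℕ) (τ : Store) : Set where
      field
        holds     : HoldsInput τ
        relocated : Relocated σ τ
        counter   : τ 2 1 ≡ x
        verdict   : τ 2 2 ≡ allCovered σ x

    check-step : ∀ {cs x τ} → x ℕ.< n → Checked x τ →
      Halts ( put 2 (lit 2) (get 2 (lit 2) *ᵉ select (m̂ -ᵉ get 7 (get 8 client))
                                                     (memberᵉ client (get 7 (get 8 client))) (lit 0))
            ⨾ put 2 (lit 1) (client +ᵉ lit 1))
            τ cs 2 (Checked (suc x))
    check-step {x = x} {τ} x<n checked = 2 , _ ,
      seq (run-put (⇓-lit 2<2^w) ⇓verdict)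
          (run-put (⇓-lit 1<2^w) (⇓-+ ⇓x′ (⇓-lit 1<2^w) 1+x<2^w)) ,
      ≤-refl , record { holds = holds ; relocated = relocated ; counter = +-comm x 1 ; verdict = refl }
      where
      open Checked checked
      j = σ 4 (σ 5 x)
      1+x<2^w : x + 1 ℕ.< 2 ^ w
      1+x<2^w = subst (ℕ._< 2 ^ w) (+-comm 1 x) (≤-<-trans x<n n<2^w)
      ⇓x : τ ⊢ client ⇓ x
      ⇓x = ⇓-get (⇓-lit 1<2^w) counter
      ⇓x′ : (τ [ 2 , 2 ≔ allCovered σ (suc x) ]) ⊢ client ⇓ x
      ⇓x′ = ⇓-get (⇓-lit 1<2^w) counter
      ⇓j : τ ⊢ get 7 (get 8 client) ⇓ j
      ⇓j = ⇓-get (⇓-get ⇓x (relocated 5 x)) (relocated 4 (σ 5 x))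
      ⇓covered : Dec (j ℕ.< m) →
        τ ⊢ select (m̂ -ᵉ get 7 (get 8 client)) (memberᵉ client (get 7 (get 8 client))) (lit 0) ⇓ covered σ x
      ⇓covered (yes j<m) = subst (τ ⊢ _ ⇓_)
        (sym (cong (if_then members (m * x + j) else 0) (dec-true (j <? m) j<m)))
        (⇓-select-suc (⇓-∸ (⇓m holds) ⇓j m<2^w) (m>n⇒m∸n≢0 j<m)
          (⇓member holds ⇓x ⇓j x<n j<m) (≤-<-trans (members≤1 _) 1<2^w))
      ⇓covered (no j≮m) = subst (τ ⊢ _ ⇓_)
        (sym (cong (if_then members (m * x + j) else 0) (dec-false (j <? m) j≮m)))
        (⇓-select-zero (⇓-bin ⊖ (⇓m holds) ⇓j (m≤n⇒m∸n≡0 (≮⇒≥ j≮m)) 0<2^w) (⇓-lit 0<2^w) 0<2^w)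
      ⇓verdict = ⇓-* (⇓-get (⇓-lit 2<2^w) verdict) (⇓covered (j <? m))
                     (≤-<-trans (allCovered≤1 σ (suc x)) 1<2^w)

    run-checkCentres : ∀ {cs τ} → Checked 0 τ → Halts checkCentres τ cs (1 + n * 3) (Checked n)
    run-checkCentres = while-halts Checked
      (λ checked → let open Checked checked in
        ⇓-∸ (⇓n holds) (⇓-get (⇓-lit 1<2^w) counter) n<2^w)
      check-step n refl

  -- Nothing is assumed about the final store σ, so the same lemma gives the time bound for all
  -- random choices and the verdict for the good ones.
  simulate : ∀ {solve cs t σ cs′} → Run w solve (KMedianInstance.input kMedian) cs t σ cs′ →
    ∃[ T ] ∃[ τ ] Run w (decideCover solve) input cs T τ cs′ × T ≤ t + overhead n m ×
                  τ 0 0 ≡ allCovered σ n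
  simulate {t = t} {σ} {cs′} run =
    let t₁ , _ , r₁ , t₁≤ , copied = run-copyScalars
        t₂ , σ₂ , r₂ , t₂≤ , filled = run-fillTables copied
        σ₃ , r₃ , relocated , agree = run-relocate run (partial-relocates filled)
        below : ∀ a i → a ℕ.< 3 → σ₃ a i ≡ partial (N * N) a i
        below = λ a i a<3 → trans (agree a i a<3) (filled a i)
        t₄ , σ₄ , r₄ , t₄≤ , checked = run-checkCentres {σ} {cs′} {σ₃ [ 2 , 2 ≔ 1 ]} (record
          { holds     = (λ i → below 0 i (s≤s z≤n)) , (λ i → below 1 i (s≤s (s≤s z≤n)))
          ; relocated = relocated
          -- The client counter is never initialised: it is 0 in the input, and neither the filling
          -- loop nor the relocated solver writes it.
          ; counter   = below 2 1 ≤-refl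
          ; verdict   = refl
          })
    in _ , _ ,
       cond-true (λ k≡0 → <⇒≢ 0<k (trans (sym k≡0) (eval≡ (⇓k {input} ((λ _ → refl) , (λ _ → refl))))))
         (seq r₁ (seq r₂ (seq r₃ (seq (run-put (⇓-lit 2<2^w) (⇓-lit 1<2^w)) (seq r₄
           (run-put (⇓-lit 0<2^w) (⇓-get (⇓-lit 2<2^w) (Checked.verdict checked)))))))) ,
       total t₁≤ t₂≤ t₄≤ , refl
    where
    total : ∀ {t₁ t₂ t₄} → t₁ ≤ 3 → t₂ ≤ 1 + N * N * 4 → t₄ ≤ 1 + n * 3 →
            suc (t₁ + (t₂ + (t + (1 + (t₄ + 1))))) ≤ t + overhead n m
    total p q r = ≤-trans
      (s≤s (+-mono-≤ p (+-mono-≤ q (+-monoʳ-≤ t (s≤s (+-monoˡ-≤ 1 r))))))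
      (≤-reflexive (rearrange t n (N * N)))
      where
      -- The 8 in `overhead` collects the outer test, three copies, two loop exits and two writes of
      -- the verdict.
      rearrange : ∀ t n z → 1 + (3 + (1 + z * 4 + (t + (1 + (1 + n * 3 + 1))))) ≡ t + (8 + 3 * n + 4 * z)
      rearrange = solve-∀

  -- The verdict decides coverability

  module Correctness {σ : Store} (correct : KMedianInstance.Correct kMedian σ) where

    open KMedianInstance kMedian using (Solution; Optimal; module Solution)

    Stored : Fin n → Fin m → Set
    Stored x j = σ 4 (σ 5 (toℕ x)) ≡ toℕ j

    covered≡ : ∀ {x j} → Stored x j → covered σ (toℕ x) ≡ bit (lookup (S j) x)
    covered≡ {x} {j} stored rewrite stored = trans
      (cong (if_then members (m * toℕ x + toℕ j) else 0) (dec-true (toℕ j <? m) (toℕ<n j)))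
      (table-combine (λ x j → bit (lookup (S j) x)) x j)

    covered≢0⇒Stored : ∀ x → covered σ (toℕ x) ≢ 0 → ∃[ j ] Stored x j
    covered≢0⇒Stored x ≢0 with σ 4 (σ 5 (toℕ x)) <? m
    ... | yes j<m = fromℕ< j<m , sym (toℕ-fromℕ< j<m)
    ... | no  j≮m = contradiction
      (cong (if_then members (m * toℕ x + σ 4 (σ 5 (toℕ x))) else 0) (dec-false (_ <? m) j≮m)) ≢0

    allCovered≡1 : ∀ l → (∀ {x} → x ℕ.< l → covered σ x ≡ 1) → allCovered σ l ≡ 1
    allCovered≡1 zero    all = refl
    allCovered≡1 (suc l) all = cong₂ _*_ (allCovered≡1 l λ x<l → all (m≤n⇒m≤1+n x<l)) (all ≤-refl)

    allCovered≢0⇒covered≢0 : ∀ l → allCovered σ l ≢ 0 → ∀ {x} → x ℕ.< l → covered σ x ≢ 0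
    allCovered≢0⇒covered≢0 (suc l) ≢0 {x} x<1+l ≡0 with x ≟ l
    ... | yes refl = ≢0 (trans (cong (allCovered σ l *_) ≡0) (*-zeroʳ (allCovered σ l)))
    ... | no  x≢l  = allCovered≢0⇒covered≢0 l (λ eq → ≢0 (cong (_* covered σ l) eq))
                       (≤∧≢⇒< (≤-pred x<1+l) x≢l) ≡0

    stored-centre : ∀ s → Solution.StoredIn s σ → ∀ x → Stored x (Solution.centre s (Solution.cluster s x))
    stored-centre s (_ , centres , clusters) x =
      trans (cong (σ 4) (clusters x)) (centres (Solution.cluster s x))

    Coverable⇒allCovered : Coverable → allCovered σ n ≡ 1
    Coverable⇒allCovered coverable =
      let s′ , cover = Coverable⇒CentresCover coverable
          s , optimal , stored = correct s′
          member x = []=⇒lookup (Optimal⇒CentresCover {s} {s′} optimal cover x)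
          all : ∀ x → covered σ (toℕ x) ≡ 1
          all = λ x → trans (covered≡ (stored-centre s stored x)) (cong bit (member x))
      in allCovered≡1 n λ x<n → subst (λ x → covered σ x ≡ 1) (toℕ-fromℕ< x<n) (all (fromℕ< x<n))

    -- Without clients there may be no facility to name, so the solution then has no cluster;
    -- otherwise a single cluster at the first client's facility fits, as k is positive.
    oneCluster : ∀ l → (Fin l → Fin m) →
                 ∃[ s ] s ≤ k × (Fin s → Fin m) × (Fin l → Fin s)
    oneCluster zero    f = 0 , z≤n , (λ ()) , (λ ())
    oneCluster (suc l) f = 1 , 0<k , (λ _ → f zero) , (λ _ → zero)

    -- `correct` has to be handed a solution before it reveals the stored one. The passed tests name
    -- a facility for each client, from which `oneCluster` makes a throwaway solution; the cover is
    -- then read off from the stored solution, which brings the bound k on the number of centres.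
    allCovered⇒Coverable : allCovered σ n ≢ 0 → Coverable
    allCovered⇒Coverable ≢0 =
      let covered≢0 : ∀ x → covered σ (toℕ x) ≢ 0
          covered≢0 = λ x → allCovered≢0⇒covered≢0 n ≢0 (toℕ<n x)
          size , size≤k , centre , cluster = oneCluster n λ x → proj₁ (covered≢0⇒Stored x (covered≢0 x))
          s , _ , stored = correct (record
            { size = size ; size≤k = size≤k ; centre = centre ; cluster = cluster })
      in CentresCover⇒Coverable s λ x → lookup⇒[]= x _ (bit≢0⇒true λ bit≡0 →
           covered≢0 x (trans (covered≡ (stored-centre s stored x)) bit≡0))
      where
      bit≢0⇒true : ∀ {b} → bit b ≢ 0 → b ≡ true
      bit≢0⇒true {true}  _  = refl
      bit≢0⇒true {false} ≢0 = contradiction refl ≢0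

    correct-verdict : ∀ {τ} → τ 0 0 ≡ allCovered σ n → Correct τ
    correct-verdict τ≡ with allCovered σ n ≟ 0
    ... | yes ≡0 = inj₂ ((λ coverable → 0≢1+n (trans (sym ≡0) (Coverable⇒allCovered coverable))) ,
                         trans τ≡ ≡0)
    ... | no  ≢0 = inj₁ (allCovered⇒Coverable ≢0 ,
                         trans τ≡ (Coverable⇒allCovered (allCovered⇒Coverable ≢0)))

decideCover-k≡0 : ∀ (I : SetCoverInstance) solve {w} → SetCoverInstance.k I ≡ 0 →
  3 ℕ.< 2 ^ w → SetCoverInstance.n I ℕ.< 2 ^ w →
  ∃[ τ ] Run w (decideCover solve) (SetCoverInstance.input I) [] 2 τ [] × SetCoverInstance.Correct I τ
decideCover-k≡0 I solve {w} k≡0 3<2^w n<2^w =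
  _ , cond-false (eval≡ ⇓k) (run-put (⇓-lit 0<2^w) (⇓-∸ (⇓-lit 1<2^w) ⇓n 1<2^w)) , verdict n refl
  where
  open SetCoverInstance I
  1<2^w : 1 ℕ.< 2 ^ w
  1<2^w = <-trans (s≤s (s≤s z≤n)) 3<2^w
  open WordRAM w 1<2^w
  ⇓k : input ⊢ k̂ ⇓ 0
  ⇓k = ⇓-get (⇓-lit (<-trans (s≤s (s≤s (s≤s z≤n))) 3<2^w)) k≡0
  ⇓n : input ⊢ n̂ ⇓ n
  ⇓n = ⇓-get (⇓-lit 0<2^w) refl
  empty : ∀ {l} → l ≤ k → ¬ Fin l
  empty l≤k i with subst (_ ≤_) k≡0 l≤k
  empty l≤k () | z≤n
  verdict : ∀ l → n ≡ l → Correct (input [ 0 , 0 ≔ 1 ∸ n ])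
  verdict zero n≡0 = inj₁
    ( (⊥ , ≤-trans (≤-reflexive (∣⊥∣≡0 m)) z≤n , (λ x → contradiction (subst Fin n≡0 x) λ ()))
    , cong (1 ∸_) n≡0)
  verdict (suc l) n≡1+l = inj₂
    ( (λ (J , ∣J∣≤k , cover) →
        let _ , j∈J , _ = cover (subst Fin (sym n≡1+l) zero)
        in empty ∣J∣≤k (proj₁ (enumerate-surjective j∈J)))
    , trans (cong (1 ∸_) n≡1+l) (0∸n≡0 l))

-- Word sizes and the final contradiction

-- If B bounds the Set Cover input, then B² bounds the k-median input and B⁴ the table indices,
-- whence the word size factor 2c + 4.
module WordSizes (c : ℕ) {Δ : ℕ} (I : SetCoverInstance)
  (small : ∀ j → ∣ SetCoverInstance.S I j ∣ ≤ Δ) (w : ℕ)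
  (size : WordSize (SetCover Δ) (2 * c + 4) (I , small) w) where

  open SetCoverInstance I

  B : ℕ
  B = proj₁ size

  input<B : ∀ a i → input a i ℕ.< B
  input<B = proj₁ (proj₂ (proj₂ size))

  2≤B : 2 ≤ B
  2≤B = ≤-<-trans (m^n>0 2 n) (proj₁ (proj₂ size))

  instance
    B≢0 : ℕ.NonZero B
    B≢0 = ℕ.>-nonZero (≤-trans (s≤s z≤n) 2≤B)

  B^e≤2^w : ∀ e → e ≤ 2 * c + 4 → B ^ e ≤ 2 ^ w
  B^e≤2^w e e≤ = ≤-trans (^-monoʳ-≤ B e≤) (proj₂ (proj₂ (proj₂ size)))

  B≤B^2 : B ≤ B ^ 2
  B≤B^2 = subst (_≤ B ^ 2) (^-identityʳ B) (^-monoʳ-≤ B {1} {2} (s≤s z≤n))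

  3<B^2 : 3 ℕ.< B ^ 2
  3<B^2 = ^-monoˡ-≤ 2 2≤B

  B^2≤2^w : B ^ 2 ≤ 2 ^ w
  B^2≤2^w = B^e≤2^w 2 (≤-trans (s≤s (s≤s z≤n)) (m≤n+m 4 (2 * c)))

  3<2^w : 3 ℕ.< 2 ^ w
  3<2^w = <-≤-trans 3<B^2 B^2≤2^w

  N<B^2 : points I ℕ.< B ^ 2
  N<B^2 = begin-strict
    n + m    <⟨ +-mono-< (input<B 0 0) (input<B 0 1) ⟩
    B + B    ≡⟨ cong (B +_) (sym (+-identityʳ B)) ⟩
    2 * B    ≤⟨ *-monoˡ-≤ B 2≤B ⟩
    B * B    ≡⟨ cong (B *_) (sym (*-identityʳ B)) ⟩
    B ^ 2    ∎
    where open ≤-Reasoning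

  N<2^w : points I ℕ.< 2 ^ w
  N<2^w = <-≤-trans N<B^2 B^2≤2^w

  N²<2^w : points I * points I ℕ.< 2 ^ w
  N²<2^w = <-≤-trans (*-mono-< N<B^2 N<B^2)
    (≤-trans (≤-reflexive (sym (^-distribˡ-+-* B 2 2))) (B^e≤2^w 4 (m≤n+m 4 (2 * c))))

  module _ (0<k : 0 ℕ.< k) where

    open Reduction I 0<k

    kMedian-wordSize : WordSize KMedian c kMedian w
    kMedian-wordSize = B ^ 2 , <-≤-trans (proj₁ (proj₂ size)) B≤B^2 , entries ,
      ≤-trans (≤-reflexive (^-*-assoc B 2 c)) (B^e≤2^w (2 * c) (m≤m+n (2 * c) 4))
      where
      open KMedianInstance kMedian using (point)
      entries : ∀ a i → KMedianInstance.input kMedian a i ℕ.< B ^ 2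
      entries 0 i = <-≤-trans (input<B 0 i) B≤B^2
      entries 1 i = ≤-<-trans (table-≤ (λ u v → dist≤3 (point u) (point v)) i) 3<B^2
      entries 2 i = ≤-<-trans (table-≤ {n + m} {n + m} (λ u v → ≤-refl {1}) i) (<-trans (s≤s (s≤s z≤n)) 3<B^2)
      entries (suc (suc (suc a))) i = ≤-<-trans z≤n 3<B^2

theorem9 : SetCoverConjecture → (ε : ℚ) → 0ℚ < ε → ¬ SolvableInTime KMedian ε
theorem9 seCoCo ε 0<ε (solve , c , C , p , solves) =
  let Δ , _ , hard = seCoCo ε′ 0<ε′ in
  hard (decideCover solve , 2 * c + 4 , totalC C , totalPoly p , λ J w size → solvesCover J w size)
  where
  ε′ : ℚ
  ε′ = halfUnit (ℚ.denominator-1 ε)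

  0<ε′ : 0ℚ < ε′
  0<ε′ = ℚ.*<* (ℤ.+<+ (s≤s z≤n))

  solvesCover : ∀ {Δ} (J : Problem.Instance (SetCover Δ)) w → WordSize (SetCover Δ) (2 * c + 4) J w →
    let I = proj₁ J
        Within = WithinTime ε′ (totalC C) (totalPoly p) (SetCoverInstance.n I) (SetCoverInstance.m I)
        halts : (Store → Set) → ∀ {r} → Vec Bool r → Set
        halts = λ Result cs →
          HaltsWith (SetCover Δ) (decideCover solve) w Within Result (SetCoverInstance.input I) (toList cs)
    in ∃[ r ] ((cs : Vec Bool r) → halts (λ _ → ⊤) cs) ×
       ∃[ good ] Unique good × 2 * 2 ^ r ≤ 3 * length good × All (halts (SetCoverInstance.Correct I)) good
  solvesCover {Δ} (I , small) w size with 0 <? SetCoverInstance.k I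
  ... | no k≤0 =
    let τ , run , correct = decideCover-k≡0 I solve (n≤0⇒n≡0 (≮⇒≥ k≤0)) 3<2^w (≤-<-trans (m≤m+n n m) N<2^w)
        -- The solver is not run here: a fictitious run of 0 steps satisfies its bound, and the 2
        -- steps fit into the overhead.
        within = within-total 0<ε C p n m {0} {2} z≤n (s≤s (s≤s z≤n))
    in 0 , (λ { [] → 2 , τ , [] , run , within , tt }) ,
       [] ∷ [] , [] ∷ [] , s≤s (s≤s z≤n) , (2 , τ , [] , run , within , correct) ∷ []
    where
    open WordSizes c I small w size
    open SetCoverInstance I
  ... | yes 0<k =
    let r , halt , good , unique , many , right = solves kMedian w (kMedian-wordSize 0<k)
    -- The reduction draws no random bits of its own, so the number of bits and the list of good
    -- choices carry over unchanged.
    in r , (λ cs → transfer {Q = λ _ → ⊤} (λ _ _ → tt) (halt cs)) , good , unique , many ,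
       All.map (transfer {Q = Correct} λ {_} {τ} correct τ≡ → Correctness.correct-verdict correct {τ} τ≡) right
    where
    open WordSizes c I small w size
    open SetCoverInstance I
    open Reduction I 0<k
    open Execution I 0<k w 3<2^w N<2^w N²<2^w
    transfer : ∀ {R Q cs} → (∀ {σ τ} → R σ → τ 0 0 ≡ allCovered σ n → Q τ) →
      HaltsWith KMedian solve w (WithinTime ε C p n m) R (KMedianInstance.input kMedian) cs →
      HaltsWith (SetCover Δ) (decideCover solve) w (WithinTime ε′ (totalC C) (totalPoly p) n m) Q input cs
    transfer result (t , σ , cs′ , run , within , Rσ) =
      let T , τ , run′ , T≤ , τ≡ = simulate run
      in T , τ , cs′ , run′ , within-total 0<ε C p n m within T≤ , result Rσ τ≡
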